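{- Let $D$ be a divisor on a loopless graph $G$, let $k$ be a positive integer, and let $G^k$ be the graph obtained from $G$ by subdividing each edge of $G$ exactly $k$ times (i.e. replacing each edge by a path with $k$ inner vertices). Then the ranks of $D$ in $G$ and in $G^k$ are the same: $r_G(D)=r_{G^k}(D)$, where on the right $D$ is regarded as a divisor on $G^k$ via $V(G)\subseteq V(G^k)$ (value $0$ at the new vertices).
   Context: A graph $G$ is a finite connected multigraph (parallel edges allowed); it is loopless if it has no loops. A divisor on $G$ is an element $D=\sum_{v\in V(G)}D(v)(v)$, $D(v)\in\mathbb Z$, of the free abelian group $\mathrm{Div}(G)$ on $V(G)$; it is effective ($D\ge 0$) if $D(v)\ge 0$ for all $v$; its degree is $\deg(D)=\sum_v D(v)$. For $f:V(G)\to\mathbb Z$ let $\mathrm{div}(f)=\sum_{v\in V(G)}\sum_{e=vw\in E(G)}(f(v)-f(w))(v)$. Divisors $D,D'$ on $G$ are equivalent, $D\sim D'$, if $D-D'=\mathrm{div}(f)$ for some $f:V(G)\to\mathbb Z$. Put $|D|=\{E\in \mathrm{Div}(G): E\ge 0,\ E\sim D\}$. The rank of $D$ on $G$ is $$r_G(D)=\min\{\deg(E): E\in\mathrm{Div}(G),\ E\ge 0,\ |D-E|=\emptyset\}-1 .$$ -}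

module Defs where

open import Data.Bool.Base using (if_then_else_)
open import Data.Empty using (⊥-elim)
open import Data.Fin.Base using (Fin; zero; suc; toℕ; fromℕ; fromℕ<; inject₁; _↑ˡ_; _↑ʳ_; splitAt; join; combine; remQuot)
open import Data.Fin.Properties using (_≟_; any?; all?; toℕ<n; toℕ-fromℕ<; join-splitAt; remQuot-combine; combine-remQuot)
open import Data.Fin.Relation.Unary.Top using (view; view-fromℕ; view-inject₁; ‵fromℕ; ‵inject₁)
open import Data.Integer.Base using (ℤ; +_; -[1+_]; 0ℤ; 1ℤ; _+_; _-_; -_; _≤_; ∣_∣; +≤+; -≤+; +<+)
import Data.Integer.Properties as ℤ
open import Data.Integer.Tactic.RingSolver using (solve-∀)
open import Data.Nat.Base as ℕ using (ℕ; NonZero; z≤n; s≤s)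
import Data.Nat.Properties as ℕ
open import Data.Product using (∃; ∃-syntax; _×_; _,_; proj₁)
open import Data.Sum.Base using (_⊎_; inj₁; inj₂; [_,_]′; swap)
open import Data.Vec.Functional using (_∷_)
open import Function.Base using (_∘_; const; case_of_)
open import Level using (0ℓ)
open import Relation.Binary.Construct.Closure.ReflexiveTransitive using (Star; ε; _◅_; _◅◅_; reverse; kleisliStar)
open import Relation.Binary.PropositionalEquality
open import Relation.Nullary using (Dec; yes; no; does; ¬?)
open import Relation.Nullary.Decidable using (map′; _×-dec_)
open import Relation.Unary using (Pred; _∈_; Empty; Satisfiable)

open import Algebra.Properties.CommutativeMonoid.Sum ℤ.+-0-commutativeMonoid
  using (sum; sum-syntax; ∑-comm; ∑-distrib-+; sum-cong-≗; sum-replicate-zero)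

------------------------------------------------------------------------
-- Graphs

-- Undirected: src and tgt are an arbitrary labelling of the two ends of an edge.
record Graph : Set where
  field
    #V #E   : ℕ
    src tgt : Fin #E → Fin #V

  Vertex : Set
  Vertex = Fin #V

  Edge : Set
  Edge = Fin #E

  Adjacent : Vertex → Vertex → Set
  Adjacent u v = ∃[ e ] ((src e ≡ u × tgt e ≡ v) ⊎ (src e ≡ v × tgt e ≡ u))

  field
    {{nonempty}} : NonZero #V
    connected    : ∀ u v → Star Adjacent u v

open Graph

Loopless : Graph → Set
Loopless G = ∀ e → src G e ≢ tgt G e

------------------------------------------------------------------------
-- Bounded search and finite sums

module Finite where

  search : ∀ {n} (b : Fin n → ℕ) {P : (Fin n → ℕ) → Set} →
           (∀ {g h} → (∀ i → g i ≡ h i) → P g → P h) → (∀ g → Dec (P g)) →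
           Dec (∃[ g ] ((∀ i → g i ℕ.≤ b i) × P g))
  search {ℕ.zero} b {P} ext P? =
    map′ (λ p → g₀ , (λ ()) , p) (λ (g , _ , p) → ext (λ ()) p) (P? g₀)
    where
    g₀ : Fin 0 → ℕ
    g₀ ()
  search {ℕ.suc n} b {P} ext P? =
    map′ to from (any? λ (a : Fin (ℕ.suc (b zero))) →
      search (b ∘ suc) {λ h → P (toℕ a ∷ h)}
        (λ g≗h → ext λ { zero → refl ; (suc i) → g≗h i }) (λ h → P? (toℕ a ∷ h)))
    where
    to : _ → _
    to (a , h , h≤b , p) =
      toℕ a ∷ h , (λ { zero → ℕ.≤-pred (toℕ<n a) ; (suc i) → h≤b i }) , p
    from : _ → _
    from (g , g≤b , p) =
      fromℕ< (s≤s (g≤b zero)) , g ∘ suc , g≤b ∘ suc ,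
      ext (λ { zero → sym (toℕ-fromℕ< (s≤s (g≤b zero))) ; (suc i) → refl }) p

  leastℕ : ∀ {P : ℕ → Set} → (∀ n → Dec (P n)) → ∀ b → P b →
           ∃[ n ] (P n × (∀ m → P m → n ℕ.≤ m))
  leastℕ P? b p with P? 0
  ... | yes p₀ = 0 , p₀ , λ _ _ → z≤n
  leastℕ P? ℕ.zero p | no ¬p₀ = ⊥-elim (¬p₀ p)
  leastℕ P? (ℕ.suc b) p | no ¬p₀ =
    let n , pₙ , least = leastℕ (P? ∘ ℕ.suc) b p in
    ℕ.suc n , pₙ , λ { ℕ.zero p₀ → ⊥-elim (¬p₀ p₀) ; (ℕ.suc m) pₘ → s≤s (least m pₘ) }

  argmin : ∀ {n} {{_ : NonZero n}} (f : Fin n → ℤ) → ∃[ v ] (∀ w → f v ≤ f w)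
  argmin {ℕ.suc ℕ.zero} f = zero , λ { zero → ℤ.≤-refl }
  argmin {ℕ.suc (ℕ.suc n)} f with argmin (f ∘ suc)
  ... | v , least with ℤ.≤-total (f zero) (f (suc v))
  ... | inj₁ le = zero , λ { zero → ℤ.≤-refl ; (suc w) → ℤ.≤-trans le (least w) }
  ... | inj₂ ge = suc v , λ { zero → ge ; (suc w) → least w }

  ∑-≤ : ∀ {n} (t : Fin n → ℤ) (c : ℕ) → (∀ i → t i ≤ + c) →
        ∑[ i < n ] t i ≤ + (n ℕ.* c)
  ∑-≤ {ℕ.zero} t c t≤c = ℤ.≤-refl
  ∑-≤ {ℕ.suc n} t c t≤c = ℤ.+-mono-≤ (t≤c zero) (∑-≤ (t ∘ suc) c (t≤c ∘ suc))

  ∑-≤-at : ∀ {n} (t : Fin n → ℤ) (c : ℕ) (x : ℤ) → (∀ i → t i ≤ + c) →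
           ∀ j → t j ≤ + c - x → ∑[ i < n ] t i ≤ + (n ℕ.* c) - x
  ∑-≤-at {ℕ.suc n} t c x t≤c zero tj≤ = ℤ.≤-trans
    (ℤ.+-mono-≤ tj≤ (∑-≤ (t ∘ suc) c (t≤c ∘ suc)))
    (ℤ.≤-reflexive (rearrange (+ c) x (+ (n ℕ.* c))))
    where
    rearrange : ∀ a y b → (a - y) + b ≡ (a + b) - y
    rearrange = solve-∀
  ∑-≤-at {ℕ.suc n} t c x t≤c (suc j) tj≤ = ℤ.≤-trans
    (ℤ.+-mono-≤ (t≤c zero) (∑-≤-at (t ∘ suc) c x (t≤c ∘ suc) j tj≤))
    (ℤ.≤-reflexive (sym (ℤ.+-assoc (+ c) (+ (n ℕ.* c)) (- x))))

  ∑-mono-0 : ∀ {n} (t : Fin n → ℤ) → (∀ i → 0ℤ ≤ t i) → 0ℤ ≤ ∑[ i < n ] t i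
  ∑-mono-0 {ℕ.zero} t 0≤t = ℤ.≤-refl
  ∑-mono-0 {ℕ.suc n} t 0≤t = ℤ.+-mono-≤ (0≤t zero) (∑-mono-0 (t ∘ suc) (0≤t ∘ suc))

  ∑-upper : ∀ {n} (t : Fin n → ℤ) → (∀ i → 0ℤ ≤ t i) → ∀ j → t j ≤ ∑[ i < n ] t i
  ∑-upper {ℕ.suc n} t 0≤t zero = subst (_≤ sum t) (ℤ.+-identityʳ (t zero))
    (ℤ.+-monoʳ-≤ (t zero) (∑-mono-0 (t ∘ suc) (0≤t ∘ suc)))
  ∑-upper {ℕ.suc n} t 0≤t (suc j) = subst (_≤ sum t) (ℤ.+-identityˡ (t (suc j)))
    (ℤ.+-mono-≤ (0≤t zero) (∑-upper (t ∘ suc) (0≤t ∘ suc) j))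

  ∑-neg : ∀ {n} (t : Fin n → ℤ) → ∑[ i < n ] (- t i) ≡ - (∑[ i < n ] t i)
  ∑-neg {ℕ.zero} t = refl
  ∑-neg {ℕ.suc n} t = trans (cong (λ x → - t zero + x) (∑-neg (t ∘ suc)))
    (sym (ℤ.neg-distrib-+ (t zero) (sum (t ∘ suc))))

  ∑-- : ∀ {n} (s t : Fin n → ℤ) → ∑[ i < n ] (s i - t i) ≡ ∑[ i < n ] s i - ∑[ i < n ] t i
  ∑-- s t = trans (∑-distrib-+ s (-_ ∘ t)) (cong (λ x → sum s + x) (∑-neg t))

  ∑-single : ∀ {n} (t : Fin n → ℤ) x → ∑[ v < n ] (if does (v ≟ x) then t v else 0ℤ) ≡ t x
  ∑-single {ℕ.suc n} t zero =
    trans (cong (λ x → t zero + x) (sum-replicate-zero n)) (ℤ.+-identityʳ (t zero))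
  ∑-single {ℕ.suc n} t (suc x) = trans (ℤ.+-identityˡ _)
    (∑-single (t ∘ suc) x)

open Finite

------------------------------------------------------------------------
-- Divisors

IsMinimum : Pred ℤ 0ℓ → ℤ → Set
IsMinimum P d = d ∈ P × (∀ d′ → d′ ∈ P → d ≤ d′)

module Divisors (G : Graph) where

  Div : Set
  Div = Vertex G → ℤ

  Effective : Div → Set
  Effective D = ∀ v → 0ℤ ≤ D v

  deg : Div → ℤ
  deg D = ∑[ v < #V G ] D v

  infixl 6 _-ᴰ_
  _-ᴰ_ : Div → Div → Div
  (D -ᴰ E) v = D v - E v

  slope : (Vertex G → ℤ) → Vertex G → Vertex G → Vertex G → ℤ
  slope f v x w = if does (v ≟ x) then f v - f w else 0ℤ

  -- Each edge is visited once from each of its two ends, and contributes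
  -- f v - f w for every end that equals v (w being the other end).
  div : (Vertex G → ℤ) → Div
  div f v = ∑[ e < #E G ] (slope f v (src G e) (tgt G e) + slope f v (tgt G e) (src G e))

  infix 4 _∼_
  _∼_ : Div → Div → Set
  D ∼ D′ = ∃[ f ] (∀ v → (D -ᴰ D′) v ≡ div f v)

  -- The complete linear system |D|.
  ∥_∥ : Div → Pred Div 0ℓ
  ∥ D ∥ E = Effective E × E ∼ D

  -- The degrees over which the minimum in the definition of the rank is taken.
  BlockingDegree : Div → Pred ℤ 0ℓ
  BlockingDegree D d = ∃[ E ] (Effective E × Empty ∥ D -ᴰ E ∥ × deg E ≡ d)

  ----------------------------------------------------------------------
  -- Existence of the minimum.  Non-emptiness of ∥ D ∥ is decided by bounded
  -- search: if D + div f ≥ 0 with min f = 0 attained at v₀, then the values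
  -- of f are bounded along any walk starting at v₀.

  slope-cong : ∀ (f g : Vertex G → ℤ) → (∀ x y → f x - f y ≡ g x - g y) →
               ∀ v x w → slope f v x w ≡ slope g v x w
  slope-cong f g eq v x w with v ≟ x
  ... | yes _ = eq v w
  ... | no  _ = refl

  div-cong : ∀ (f g : Vertex G → ℤ) → (∀ x y → f x - f y ≡ g x - g y) →
             ∀ v → div f v ≡ div g v
  div-cong f g eq v = sum-cong-≗ λ e → cong₂ _+_
    (slope-cong f g eq v (src G e) (tgt G e)) (slope-cong f g eq v (tgt G e) (src G e))

  deg-div : ∀ f → deg (div f) ≡ 0ℤ
  deg-div f = begin
    ∑[ v < #V G ] ∑[ e < #E G ] (fwd v e + bwd v e)
      ≡⟨ ∑-comm (λ v e → fwd v e + bwd v e) ⟩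
    ∑[ e < #E G ] ∑[ v < #V G ] (fwd v e + bwd v e)
      ≡⟨ sum-cong-≗ (λ e → trans (∑-distrib-+ (λ v → fwd v e) (λ v → bwd v e))
           (trans (cong₂ _+_ (∑-single (λ v → f v - f (tgt G e)) (src G e))
                             (∑-single (λ v → f v - f (src G e)) (tgt G e)))
                  (cancel (f (src G e)) (f (tgt G e))))) ⟩
    ∑[ e < #E G ] 0ℤ
      ≡⟨ sum-replicate-zero (#E G) ⟩
    0ℤ ∎
    where
    open ≡-Reasoning
    fwd bwd : Vertex G → Edge G → ℤ
    fwd v e = slope f v (src G e) (tgt G e)
    bwd v e = slope f v (tgt G e) (src G e)
    cancel : ∀ a b → (a - b) + (b - a) ≡ 0ℤ
    cancel = solve-∀

  slope-≤ : ∀ (g : Vertex G → ℕ) v x w → slope (+_ ∘ g) v x w ≤ + g v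
  slope-≤ g v x w with v ≟ x
  ... | yes _ = ℤ.i-j≤i (+ g v) (+ g w)
  ... | no  _ = +≤+ z≤n

  slope-at : ∀ (g : Vertex G → ℕ) v w → slope (+_ ∘ g) v v w ≤ + g v - + g w
  slope-at g v w with v ≟ v
  ... | yes _ = ℤ.≤-refl
  ... | no v≢v = ⊥-elim (v≢v refl)

  Winning : Div → (Vertex G → ℤ) → Set
  Winning D f = ∀ v → 0ℤ ≤ D v + div f v

  stepBound : Div → Vertex G → ℕ → ℕ
  stepBound D u b = ∣ D u ∣ ℕ.+ #E G ℕ.* (b ℕ.+ b)

  walkBound : Div → ∀ {u v} → ℕ → Star (Adjacent G) u v → ℕ
  walkBound D b ε = b
  walkBound D b (_◅_ {u} _ p) = walkBound D (stepBound D u b) p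

  i≤∣i∣ : ∀ i → i ≤ + ∣ i ∣
  i≤∣i∣ (+ n) = ℤ.≤-refl
  i≤∣i∣ -[1+ n ] = -≤+

  step-≤ : ∀ D (g : Vertex G → ℕ) → Winning D (+_ ∘ g) → ∀ {u w b} →
           g u ℕ.≤ b → Adjacent G u w → g w ℕ.≤ stepBound D u b
  step-≤ D g win {u} {w} {b} gu≤b (e , adj) = ℤ.drop‿+≤+ (begin
    + g w
      ≡⟨ ℤ.+-identityˡ _ ⟨
    0ℤ + + g w
      ≤⟨ ℤ.+-monoˡ-≤ (+ g w) (win u) ⟩
    D u + div (+_ ∘ g) u + + g w
      ≤⟨ ℤ.+-monoˡ-≤ (+ g w) (ℤ.+-mono-≤ (i≤∣i∣ (D u))
           (∑-≤-at term (b ℕ.+ b) (+ g w) term≤ e (term-at adj))) ⟩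
    + ∣ D u ∣ + (+ (#E G ℕ.* (b ℕ.+ b)) - + g w) + + g w
      ≡⟨ cancel (+ ∣ D u ∣) (+ (#E G ℕ.* (b ℕ.+ b))) (+ g w) ⟩
    + ∣ D u ∣ + + (#E G ℕ.* (b ℕ.+ b)) ∎)
    where
    open ℤ.≤-Reasoning
    term : Edge G → ℤ
    term e = slope (+_ ∘ g) u (src G e) (tgt G e) + slope (+_ ∘ g) u (tgt G e) (src G e)
    half : ∀ x y → slope (+_ ∘ g) u x y ≤ + b
    half x y = ℤ.≤-trans (slope-≤ g u x y) (+≤+ gu≤b)
    half-at : slope (+_ ∘ g) u u w ≤ + b - + g w
    half-at = ℤ.≤-trans (slope-at g u w) (ℤ.+-monoˡ-≤ (- (+ g w)) (+≤+ gu≤b))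
    term≤ : ∀ e → term e ≤ + (b ℕ.+ b)
    term≤ e = ℤ.+-mono-≤ (half _ _) (half _ _)
    cancel : ∀ a m x → a + (m - x) + x ≡ a + m
    cancel = solve-∀
    comb₁ : ∀ a x → (a - x) + a ≡ (a + a) - x
    comb₁ = solve-∀
    comb₂ : ∀ a x → a + (a - x) ≡ (a + a) - x
    comb₂ = solve-∀
    term-at : ∀ {e} → (src G e ≡ u × tgt G e ≡ w) ⊎ (src G e ≡ w × tgt G e ≡ u) →
              term e ≤ + (b ℕ.+ b) - + g w
    term-at (inj₁ (refl , refl)) = ℤ.≤-trans (ℤ.+-mono-≤ half-at (half _ _))
      (ℤ.≤-reflexive (comb₁ (+ b) (+ g w)))
    term-at (inj₂ (refl , refl)) = ℤ.≤-trans (ℤ.+-mono-≤ (half _ _) half-at)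
      (ℤ.≤-reflexive (comb₂ (+ b) (+ g w)))

  walk-≤ : ∀ D (g : Vertex G → ℕ) → Winning D (+_ ∘ g) → ∀ {u w b} →
           g u ℕ.≤ b → (p : Star (Adjacent G) u w) → g w ℕ.≤ walkBound D b p
  walk-≤ D g win gu≤b ε = gu≤b
  walk-≤ D g win gu≤b (a ◅ p) = walk-≤ D g win (step-≤ D g win gu≤b a) p

  winning-cong : ∀ D f g → (∀ x y → f x - f y ≡ g x - g y) → Winning D f → Winning D g
  winning-cong D f g eq win v = subst (λ x → 0ℤ ≤ D v + x) (div-cong f g eq v) (win v)

  winning? : ∀ D → Dec (∃[ f ] Winning D f)
  winning? D = map′ to from
    (any? λ v₀ → search (λ v → walkBound D 0 (connected G v₀ v)) {Winning D ∘ (+_ ∘_)}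
      (λ {g} {h} g≗h → winning-cong D (+_ ∘ g) (+_ ∘ h)
        (λ x y → cong₂ (λ a b → + a - + b) (g≗h x) (g≗h y)))
      (λ g → all? λ v → 0ℤ ℤ.≤? _))
    where
    to : _ → _
    to (_ , g , _ , win) = +_ ∘ g , win
    from : (∃[ f ] Winning D f) → _
    from (f , win) with argmin f
    ... | v₀ , least = v₀ , g , (λ v → walk-≤ D g win′ g₀ (connected G v₀ v)) , win′
      where
      g : Vertex G → ℕ
      g v = ∣ f v - f v₀ ∣
      +g : ∀ v → + g v ≡ f v - f v₀
      +g v = ℤ.0≤i⇒+∣i∣≡i (ℤ.i≤j⇒0≤j-i (least v))
      shift : ∀ a b c → a - b ≡ (a - c) - (b - c)
      shift = solve-∀
      win′ : Winning D (+_ ∘ g)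
      win′ = winning-cong D f (+_ ∘ g)
        (λ x y → trans (shift (f x) (f y) (f v₀)) (sym (cong₂ _-_ (+g x) (+g y)))) win
      g₀ : g v₀ ℕ.≤ 0
      g₀ = ℕ.≤-reflexive (cong ∣_∣ (ℤ.+-inverseʳ (f v₀)))

  winning⇒satisfiable : ∀ D → (∃[ f ] Winning D f) → Satisfiable ∥ D ∥
  winning⇒satisfiable D (f , win) =
    (λ v → D v + div f v) , win , f , λ v → cancel (D v) (div f v)
    where
    cancel : ∀ a b → a + b - a ≡ b
    cancel = solve-∀

  satisfiable⇒winning : ∀ D → Satisfiable ∥ D ∥ → ∃[ f ] Winning D f
  satisfiable⇒winning D (E , E≥0 , f , eq) = f , λ v →
    subst (0ℤ ≤_) (trans (split (E v) (D v)) (cong (λ x → D v + x) (eq v))) (E≥0 v)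
    where
    split : ∀ a b → a ≡ b + (a - b)
    split = solve-∀

  empty? : ∀ D → Dec (Empty ∥ D ∥)
  empty? D = map′ (λ ¬s E E∈ → ¬s (satisfiable⇒winning D (E , E∈)))
    (λ em win → let E , E∈ = winning⇒satisfiable D win in em E E∈) (¬? (winning? D))

  empty-cong : ∀ {D D′ : Div} → (∀ v → D v ≡ D′ v) → Empty ∥ D ∥ → Empty ∥ D′ ∥
  empty-cong D≗D′ em E (E≥0 , f , eq) =
    em E (E≥0 , f , λ v → trans (cong (λ x → E v - x) (D≗D′ v)) (eq v))

  blocking? : ∀ D d → Dec (BlockingDegree D (+ d))
  blocking? D d = map′ to from (search (const d) {P}
      (λ g≗h (em , dg) →
        empty-cong (λ v → cong (λ a → D v - + a) (g≗h v)) em ,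
        trans (sym (sum-cong-≗ (cong +_ ∘ g≗h))) dg)
      (λ g → empty? _ ×-dec (_ ℤ.≟ _)))
    where
    P : (Vertex G → ℕ) → Set
    P g = Empty ∥ D -ᴰ (+_ ∘ g) ∥ × deg (+_ ∘ g) ≡ + d
    to : (∃[ g ] ((∀ v → g v ℕ.≤ d) × P g)) → BlockingDegree D (+ d)
    to (g , _ , em , dg) = +_ ∘ g , (λ v → +≤+ z≤n) , em , dg
    from : BlockingDegree D (+ d) → ∃[ g ] ((∀ v → g v ℕ.≤ d) × P g)
    from (E , E≥0 , em , dg) = ∣_∣ ∘ E ,
      (λ v → ℤ.drop‿+≤+ (subst₂ _≤_ (sym (+∣E∣ v)) dg (∑-upper E E≥0 v))) ,
      empty-cong (λ v → cong (λ a → D v - a) (sym (+∣E∣ v))) em ,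
      trans (sum-cong-≗ +∣E∣) dg
      where
      +∣E∣ : ∀ v → + ∣ E v ∣ ≡ E v
      +∣E∣ v = ℤ.0≤i⇒+∣i∣≡i (E≥0 v)

  -- An effective divisor of degree larger than deg D blocks D.
  someBlockingDegree : ∀ D → ∃[ d ] BlockingDegree D (+ d)
  someBlockingDegree D = d , E , E≥0 , em , degE
    where
    d : ℕ
    d = ℕ.suc ∣ deg D ∣
    x : Vertex G
    x = fromℕ< (ℕ.>-nonZero⁻¹ (#V G))
    E : Div
    E v = if does (v ≟ x) then + d else 0ℤ
    E≥0 : Effective E
    E≥0 v with v ≟ x
    ... | yes _ = +≤+ z≤n
    ... | no  _ = +≤+ z≤n
    degE : deg E ≡ + d
    degE = ∑-single (const (+ d)) x
    em : Empty ∥ D -ᴰ E ∥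
    em F (F≥0 , f , eq) = ℤ.<⇒≱ (+<+ (ℕ.n<1+n ∣ deg D ∣)) (begin
      + d                            ≡⟨ ℤ.+-identityˡ _ ⟨
      0ℤ + + d                       ≤⟨ ℤ.+-monoˡ-≤ (+ d) (∑-mono-0 F F≥0) ⟩
      deg F + + d                    ≡⟨ cong (λ x → x + + d) degF ⟩
      deg D - + d + + d              ≡⟨ cancel (deg D) (+ d) ⟩
      deg D                          ≤⟨ i≤∣i∣ _ ⟩
      + ∣ deg D ∣                    ∎)
      where
      open ℤ.≤-Reasoning
      cancel : ∀ a b → a - b + b ≡ a
      cancel = solve-∀
      degF : deg F ≡ deg D - + d
      degF = ℤ.i-j≡0⇒i≡j _ _ (trans
        (cong (λ a → deg F - a) (sym (trans (∑-- D E) (cong (λ a → deg D - a) degE))))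
        (trans (sym (∑-- F (D -ᴰ E))) (trans (sum-cong-≗ eq) (deg-div f))))

  minBlockingDegree : ∀ D → ∃ (IsMinimum (BlockingDegree D))
  minBlockingDegree D =
    let b , p         = someBlockingDegree D
        d , q , least = leastℕ (blocking? D) b p
    in + d , q , λ where
      (+ m) r → +≤+ (least m r)
      -[1+ m ] (E , E≥0 , _ , dg) → case subst (0ℤ ≤_) dg (∑-mono-0 E E≥0) of λ ()

  rank : Div → ℤ
  rank D = proj₁ (minBlockingDegree D) - 1ℤ

open Divisors using (Div; rank) public

------------------------------------------------------------------------
-- Subdivision

module Subdivision (k : ℕ) (G : Graph) where

  old : Vertex G → Fin (#V G ℕ.+ #E G ℕ.* k)
  old v = v ↑ˡ (#E G ℕ.* k)

  inner : Edge G → Fin k → Fin (#V G ℕ.+ #E G ℕ.* k)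
  inner e i = #V G ↑ʳ combine e i

  -- The k + 2 consecutive vertices of the path replacing e.
  path : Edge G → Fin (ℕ.suc (ℕ.suc k)) → Fin (#V G ℕ.+ #E G ℕ.* k)
  path e zero = old (src G e)
  path e (suc i) with view i
  ... | ‵fromℕ     = old (tgt G e)
  ... | ‵inject₁ j = inner e j

  -- Edge (e , j) of the subdivision joins the j-th and the (j + 1)-st vertex
  -- of the path replacing e.
  source target : Fin (#E G ℕ.* ℕ.suc k) → Fin (#V G ℕ.+ #E G ℕ.* k)
  source x = let e , j = remQuot {#E G} (ℕ.suc k) x in path e (inject₁ j)
  target x = let e , j = remQuot {#E G} (ℕ.suc k) x in path e (suc j)

  Adj : Fin (#V G ℕ.+ #E G ℕ.* k) → Fin (#V G ℕ.+ #E G ℕ.* k) → Set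
  Adj u v = ∃[ x ] ((source x ≡ u × target x ≡ v) ⊎ (source x ≡ v × target x ≡ u))

  Adj-sym : ∀ {u v} → Adj u v → Adj v u
  Adj-sym (x , p) = x , swap p

  path-step : ∀ e j → Adj (path e (inject₁ j)) (path e (suc j))
  path-step e j = combine e j , inj₁
    ( cong (λ (e , j) → path e (inject₁ j)) (remQuot-combine e j)
    , cong (λ (e , j) → path e (suc j)) (remQuot-combine e j))

  walkTo : ∀ {n} (p : Fin (ℕ.suc n) → Fin (#V G ℕ.+ #E G ℕ.* k)) →
           (∀ j → Adj (p (inject₁ j)) (p (suc j))) → ∀ i → Star Adj (p zero) (p i)
  walkTo p step zero = ε
  walkTo {ℕ.suc n} p step (suc i) = step zero ◅ walkTo (p ∘ suc) (step ∘ suc) i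

  toPath : ∀ e i → Star Adj (old (src G e)) (path e i)
  toPath e = walkTo (path e) (path-step e)

  path-last : ∀ e → path e (suc (fromℕ k)) ≡ old (tgt G e)
  path-last e rewrite view-fromℕ k = refl

  path-inner : ∀ e i → path e (suc (inject₁ i)) ≡ inner e i
  path-inner e i rewrite view-inject₁ i = refl

  fromEdge : ∀ e → Star Adj (old (src G e)) (old (tgt G e))
  fromEdge e = subst (Star Adj _) (path-last e) (toPath e (suc (fromℕ k)))

  lift : ∀ {u v} → Star (Adjacent G) u v → Star Adj (old u) (old v)
  lift = kleisliStar old λ where
    (e , inj₁ (refl , refl)) → fromEdge e
    (e , inj₂ (refl , refl)) → reverse Adj-sym (fromEdge e)

  fromOld : ∀ v → ∃[ u ] Star Adj (old u) v
  fromOld v = subst (λ v → ∃[ u ] Star Adj (old u) v) (join-splitAt (#V G) _ v)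
    (go (splitAt (#V G) v))
    where
    go : ∀ s → ∃[ u ] Star Adj (old u) (join (#V G) (#E G ℕ.* k) s)
    go (inj₁ u) = u , ε
    go (inj₂ y) = let e , i = remQuot {#E G} k y in src G e ,
      subst (Star Adj _) (trans (path-inner e i) (cong (#V G ↑ʳ_) (combine-remQuot {#E G} k y)))
        (toPath e (suc (inject₁ i)))

  subdivision-connected : ∀ u v → Star Adj u v
  subdivision-connected u v =
    let u′ , p = fromOld u ; v′ , q = fromOld v in
    reverse Adj-sym p ◅◅ lift (connected G u′ v′) ◅◅ q

subdivide : ℕ → Graph → Graph
subdivide k G = record
  { #V        = #V G ℕ.+ #E G ℕ.* k
  ; #E        = #E G ℕ.* ℕ.suc k
  ; src       = source
  ; tgt       = target
  ; nonempty  = ℕ.>-nonZero (ℕ.≤-trans (ℕ.>-nonZero⁻¹ (#V G)) (ℕ.m≤m+n (#V G) _))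
  ; connected = subdivision-connected
  }
  where open Subdivision k G

extend : ∀ k G → Div G → Div (subdivide k G)
extend k G D v = [ D , const 0ℤ ]′ (splitAt (#V G) v)

{-# OPTIONS --safe #-}
-- A function on G, scaled by k + 1 and interpolated linearly, lives on G^k; in
-- the other direction a function F on G^k with div F ≥ 0 at the inner vertices
-- is concave along the subdivided edges, and ⌊F / (k + 1)⌋ can be used on G.
-- So a divisor on G is equivalent to an effective one on G iff it is on G^k.
--
-- It remains to see that chips at inner vertices are no harder to obtain than
-- chips at old ones.  Let a and b produce a chip at the two ends (distinct, as
-- G is loopless) of the path through an inner vertex x, shifted so that
-- a x = b x.  Chips on both sides of x can be moved towards each other until one
-- lies at x.  If neither a nor b yields chips on both sides, then a - b is
-- convex before x and concave after it, so it is either increasing at x, and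
-- min(a , b) has a chip at x, or nonincreasing along the whole path, and
-- min(a , b) has chips at both ends.
module Submission where

open import Defs
open import Data.Bool.Base using (if_then_else_)
open import Data.Empty using (⊥-elim)
open import Data.Fin.Base using (Fin; zero; suc; toℕ; fromℕ; fromℕ<; inject₁; _↑ˡ_; _↑ʳ_; splitAt; join; combine; remQuot)
open import Data.Fin.Properties
  using (_≟_; any?; toℕ<n; toℕ-fromℕ<; toℕ-inject₁; toℕ-fromℕ;
         fromℕ≢inject₁; inject₁-injective; suc-injective; splitAt-↑ˡ; splitAt-↑ʳ; join-splitAt;
         remQuot-combine; combine-remQuot; combine-injective; ↑ʳ-injective; ↑ˡ-injective; ¬∀⟶∃¬)
open import Data.Fin.Relation.Unary.Top using (view; ‵fromℕ; ‵inject₁)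
open import Data.Integer.Base using (ℤ; +_; 0ℤ; 1ℤ; _+_; _-_; -_; _*_; _≤_; _<_; _⊓_; ∣_∣; +≤+; +<+)
  renaming (suc to sucℤ)
open import Data.Integer.DivMod using (_/ℕ_; [n/ℕd]*d≤n; n<s[n/ℕd]*d)
import Data.Integer.Properties as ℤ
open import Data.Integer.Tactic.RingSolver using (solve-∀)
open import Data.Nat.Base as ℕ using (ℕ; NonZero; z≤n; s≤s)
import Data.Nat.Properties as ℕ
open import Data.Product using (∃-syntax; _×_; _,_; proj₁; proj₂)
open import Data.Sum.Base using (_⊎_; inj₁; inj₂; [_,_]′)
open import Function.Base using (_∘_; const)
open import Level using (0ℓ)
open import Relation.Binary.PropositionalEquality
open import Relation.Nullary using (¬_; Dec; yes; no; does)
open import Relation.Nullary.Decidable using (_×-dec_)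
open import Relation.Unary using (Pred; _⊆_; Empty)

open import Algebra.Properties.CommutativeMonoid.Sum ℤ.+-0-commutativeMonoid
  using (sum; sum-syntax; ∑-distrib-+; sum-cong-≗; sum-replicate-zero)

open Graph
open Finite

-- Inequalities and conditional terms

0≤+ : ∀ {i j} → 0ℤ ≤ i → 0ℤ ≤ j → 0ℤ ≤ i + j
0≤+ = ℤ.+-mono-≤

≤-by : ∀ {i j d} → 0ℤ ≤ d → d ≡ j - i → i ≤ j
≤-by 0≤d eq = ℤ.0≤i-j⇒j≤i (subst (0ℤ ≤_) eq 0≤d)

if-yes : ∀ {P : Set} (P? : Dec P) {a : ℤ} → P → (if does P? then a else 0ℤ) ≡ a
if-yes (yes _) p = refl
if-yes (no ¬p) p = ⊥-elim (¬p p)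

if-no : ∀ {P : Set} (P? : Dec P) {a : ℤ} → ¬ P → (if does P? then a else 0ℤ) ≡ 0ℤ
if-no (yes p) ¬p = ⊥-elim (¬p p)
if-no (no _)  ¬p = refl

if-mono : ∀ {P : Set} (P? : Dec P) {a b : ℤ} → (P → a ≤ b) →
          (if does P? then a else 0ℤ) ≤ (if does P? then b else 0ℤ)
if-mono (yes p) a≤b = a≤b p
if-mono (no _)  a≤b = ℤ.≤-refl

if-cong : ∀ {P Q : Set} (P? : Dec P) (Q? : Dec Q) {a : ℤ} → (P → Q) → (Q → P) →
          (if does P? then a else 0ℤ) ≡ (if does Q? then a else 0ℤ)
if-cong (yes p) Q? to from = sym (if-yes Q? (to p))
if-cong (no ¬p) Q? to from = sym (if-no Q? (¬p ∘ from))

-- Finite sums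

∑-zero : ∀ {n} {t : Fin n → ℤ} → (∀ i → t i ≡ 0ℤ) → sum t ≡ 0ℤ
∑-zero {n} t≗0 = trans (sum-cong-≗ t≗0) (sum-replicate-zero n)

∑-only : ∀ {n} (t : Fin n → ℤ) x → (∀ i → i ≢ x → t i ≡ 0ℤ) → sum t ≡ t x
∑-only t x elsewhere = trans (sum-cong-≗ masked) (∑-single t x)
  where
  masked : ∀ i → t i ≡ (if does (i ≟ x) then t i else 0ℤ)
  masked i with i ≟ x
  ... | yes _  = refl
  ... | no i≢x = elsewhere i i≢x

∑-mono-≤ : ∀ {n} {s t : Fin n → ℤ} → (∀ i → s i ≤ t i) → sum s ≤ sum t
∑-mono-≤ {ℕ.zero}  s≤t = ℤ.≤-refl
∑-mono-≤ {ℕ.suc n} s≤t = ℤ.+-mono-≤ (s≤t zero) (∑-mono-≤ (s≤t ∘ suc))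

∑-↑ : ∀ m {n} (t : Fin (m ℕ.+ n) → ℤ) →
      sum t ≡ ∑[ i < m ] t (i ↑ˡ n) + ∑[ j < n ] t (m ↑ʳ j)
∑-↑ ℕ.zero    t = sym (ℤ.+-identityˡ _)
∑-↑ (ℕ.suc m) t = trans (cong (λ x → t zero + x) (∑-↑ m (t ∘ suc)))
  (sym (ℤ.+-assoc (t zero) _ _))

∑-combine : ∀ m {n} (t : Fin (m ℕ.* n) → ℤ) → sum t ≡ ∑[ i < m ] ∑[ j < n ] t (combine i j)
∑-combine ℕ.zero        t = refl
∑-combine (ℕ.suc m) {n} t = trans (∑-↑ n t)
  (cong (λ x → ∑[ j < n ] t (j ↑ˡ (m ℕ.* n)) + x) (∑-combine m (t ∘ (n ↑ʳ_))))

-- Integer sequences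

antitone : ∀ (s : ℕ → ℤ) {i j} → (∀ n → i ℕ.≤ n → n ℕ.< j → s (ℕ.suc n) ≤ s n) →
           i ℕ.≤ j → s j ≤ s i
antitone s {i} step i≤j = go step (ℕ.≤⇒≤′ i≤j)
  where
  go : ∀ {j} → (∀ n → i ℕ.≤ n → n ℕ.< j → s (ℕ.suc n) ≤ s n) → i ℕ.≤′ j → s j ≤ s i
  go step (ℕ.≤′-reflexive refl) = ℤ.≤-refl
  go step (ℕ.≤′-step i≤′n)      = ℤ.≤-trans (step _ (ℕ.≤′⇒≤ i≤′n) ℕ.≤-refl)
    (go (λ n i≤n n<j → step n i≤n (ℕ.m<n⇒m<1+n n<j)) i≤′n)

monotone : ∀ (s : ℕ → ℤ) {i j} → (∀ n → i ℕ.≤ n → n ℕ.< j → s n ≤ s (ℕ.suc n)) →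
           i ℕ.≤ j → s i ≤ s j
monotone s step i≤j = ℤ.neg-cancel-≤
  (antitone (-_ ∘ s) (λ n i≤n n<j → ℤ.neg-mono-≤ (step n i≤n n<j)) i≤j)

increment : (ℕ → ℤ) → ℕ → ℤ
increment c n = c (ℕ.suc n) - c n

rise-≤ : ∀ c b n → (∀ i → i ℕ.< n → increment c i ≤ b) → c n - c 0 ≤ + n * b
rise-≤ c b ℕ.zero    inc≤b = ℤ.≤-reflexive (cancel (c 0) b)
  where
  cancel : ∀ x b → x - x ≡ 0ℤ * b
  cancel = solve-∀
rise-≤ c b (ℕ.suc n) inc≤b = begin
  c (ℕ.suc n) - c 0                   ≡⟨ split (c (ℕ.suc n)) (c n) (c 0) ⟩
  increment c n + (c n - c 0)         ≤⟨ ℤ.+-mono-≤ (inc≤b n ℕ.≤-refl)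
                                           (rise-≤ c b n λ i i<n → inc≤b i (ℕ.m<n⇒m<1+n i<n)) ⟩
  b + + n * b                         ≡⟨ collect b (+ n) ⟩
  + ℕ.suc n * b                       ∎
  where
  open ℤ.≤-Reasoning
  split : ∀ x y z → x - z ≡ (x - y) + (y - z)
  split = solve-∀
  collect : ∀ b n → b + n * b ≡ (1ℤ + n) * b
  collect = solve-∀

-- Concavity in the shape in which the Laplacian provides it.
Concave : ℕ → (ℕ → ℤ) → Set
Concave k c = ∀ n → n ℕ.< k →
  0ℤ ≤ (c (ℕ.suc n) - c (ℕ.suc (ℕ.suc n))) + (c (ℕ.suc n) - c n)

module _ {k : ℕ} (c : ℕ → ℤ) (concave : Concave k c) where

  increment-antitone : ∀ {i j} → i ℕ.≤ j → j ℕ.≤ k → increment c j ≤ increment c i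
  increment-antitone i≤j j≤k = antitone (increment c)
    (λ n _ n<j → ≤-by (concave n (ℕ.<-≤-trans n<j j≤k)) (regroup (c n) (c (ℕ.suc n)) (c (ℕ.suc (ℕ.suc n))))) i≤j
    where
    regroup : ∀ x y z → (y - z) + (y - x) ≡ (y - x) - (z - y)
    regroup = solve-∀

  -- The first increment is the largest of the k + 1 increments, and these add up to the total rise.
  first-slope : + ℕ.suc k * (c 0 - c 1) ≤ c 0 - c (ℕ.suc k)
  first-slope = ≤-by
    (ℤ.i≤j⇒0≤j-i (rise-≤ c (increment c 0) (ℕ.suc k) λ i i<m → increment-antitone z≤n (ℕ.≤-pred i<m)))
    (regroup (+ ℕ.suc k) (c 0) (c 1) (c (ℕ.suc k)))
    where
    regroup : ∀ m x y z → m * (y - x) - (z - x) ≡ (x - z) - m * (x - y)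
    regroup = solve-∀

  -- Mirror image of `first-slope`: the last increment is the smallest, so `rise-≤` is applied to
  -- the negated sequence.
  last-slope : + ℕ.suc k * (c (ℕ.suc k) - c k) ≤ c (ℕ.suc k) - c 0
  last-slope = ≤-by
    (ℤ.i≤j⇒0≤j-i (rise-≤ (-_ ∘ c) (- increment c k) (ℕ.suc k) λ i i<m →
      ≤-by (ℤ.i≤j⇒0≤j-i (increment-antitone (ℕ.≤-pred i<m) ℕ.≤-refl))
        (flip-sign (increment c k) (c i) (c (ℕ.suc i)))))
    (regroup (+ ℕ.suc k) (c 0) (c k) (c (ℕ.suc k)))
    where
    flip-sign : ∀ d x y → (y - x) - d ≡ - d - (- y - - x)
    flip-sign = solve-∀
    regroup : ∀ m x y z → m * (- (z - y)) - (- z - - x) ≡ (z - x) - m * (z - y)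
    regroup = solve-∀

-- Rounding gives x < (⌊x/m⌋ + 1) m and ⌊y/m⌋ m ≤ y, whence a < ⌊x/m⌋ - ⌊y/m⌋ + 1; integrality
-- removes the extra 1.
/ℕ-difference : ∀ m .{{_ : NonZero m}} a x y → + m * a ≤ x - y → a ≤ x /ℕ m - y /ℕ m
/ℕ-difference m a x y ma≤x-y = subst (a ≤_) (ℤ.pred-suc _) (ℤ.i<j⇒i≤pred[j]
  (ℤ.*-cancelˡ-<-nonNeg (+ m) (begin-strict
    + m * a                                ≤⟨ ma≤x-y ⟩
    x - y                                  <⟨ ℤ.+-mono-<-≤ (n<s[n/ℕd]*d x m) (ℤ.neg-mono-≤ ([n/ℕd]*d≤n y m)) ⟩
    sucℤ (x /ℕ m) * + m - (y /ℕ m) * + m   ≡⟨ regroup (x /ℕ m) (y /ℕ m) (+ m) ⟩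
    + m * sucℤ (x /ℕ m - y /ℕ m)           ∎)))
  where
  open ℤ.≤-Reasoning
  regroup : ∀ p q m → (1ℤ + p) * m - q * m ≡ m * (1ℤ + (p - q))
  regroup = solve-∀

-- Divisors on an arbitrary graph

module _ (G : Graph) where
  open Divisors G hiding (Div; rank)

  flow : (Vertex G → ℤ) → Vertex G → Edge G → ℤ
  flow f v e = slope f v (src G e) (tgt G e) + slope f v (tgt G e) (src G e)

  div-- : ∀ f g v → div (λ w → f w - g w) v ≡ div f v - div g v
  div-- f g v = trans
    (sum-cong-≗ λ e → trans (cong₂ _+_ (slope-- (src G e) (tgt G e)) (slope-- (tgt G e) (src G e)))
      (shuffle (slope f v (src G e) (tgt G e)) (slope g v (src G e) (tgt G e))
               (slope f v (tgt G e) (src G e)) (slope g v (tgt G e) (src G e))))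
    (∑-- (flow f v) (flow g v))
    where
    shuffle : ∀ a b c d → (a - b) + (c - d) ≡ (a + c) - (b + d)
    shuffle = solve-∀
    exchange : ∀ a b c d → (a - b) - (c - d) ≡ (a - c) - (b - d)
    exchange = solve-∀
    slope-- : ∀ x y → slope (λ w → f w - g w) v x y ≡ slope f v x y - slope g v x y
    slope-- x y with v ≟ x
    ... | yes _ = exchange (f v) (g v) (f y) (g y)
    ... | no  _ = refl

  -- Each edge at v contributes f v minus the value at its other end, and lowering that value can
  -- only increase the contribution.
  div-antitone : ∀ (f g : Vertex G → ℤ) v → g v ≡ f v → (∀ w → g w ≤ f w) → div f v ≤ div g v
  div-antitone f g v gv≡fv g≤f = ∑-mono-≤ {s = flow f v} {t = flow g v} λ e →
    ℤ.+-mono-≤ (slope-≤′ (src G e) (tgt G e)) (slope-≤′ (tgt G e) (src G e))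
    where
    slope-≤′ : ∀ x y → slope f v x y ≤ slope g v x y
    slope-≤′ x y = if-mono (v ≟ x) λ _ →
      ℤ.+-mono-≤ (ℤ.≤-reflexive (sym gv≡fv)) (ℤ.neg-mono-≤ (g≤f y))

  div-⊓ˡ : ∀ (f g : Vertex G → ℤ) v → f v ≤ g v → div f v ≤ div (λ w → f w ⊓ g w) v
  div-⊓ˡ f g v le = div-antitone f (λ w → f w ⊓ g w) v (ℤ.i≤j⇒i⊓j≡i le) (λ w → ℤ.i⊓j≤i (f w) (g w))

  div-⊓ʳ : ∀ (f g : Vertex G → ℤ) v → g v ≤ f v → div g v ≤ div (λ w → f w ⊓ g w) v
  div-⊓ʳ f g v le = div-antitone g (λ w → f w ⊓ g w) v (ℤ.i≥j⇒i⊓j≡j le) (λ w → ℤ.i⊓j≤j (f w) (g w))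

  -- At each vertex the minimum agrees with the smaller of f and g and lies below it everywhere
  -- else, so its Laplacian there is at least that of the smaller one.
  winning-⊓ : ∀ D (f g : Vertex G → ℤ) → Winning D f → Winning D g → Winning D (λ w → f w ⊓ g w)
  winning-⊓ D f g winf wing v with ℤ.≤-total (f v) (g v)
  ... | inj₁ le = ℤ.≤-trans (winf v) (ℤ.+-monoʳ-≤ (D v) (div-⊓ˡ f g v le))
  ... | inj₂ ge = ℤ.≤-trans (wing v) (ℤ.+-monoʳ-≤ (D v) (div-⊓ʳ f g v ge))

  -- Single chips

  χ : Vertex G → Div G
  χ x v = if does (v ≟ x) then 1ℤ else 0ℤ

  χ-self : ∀ x → χ x x ≡ 1ℤ
  χ-self x = if-yes (x ≟ x) refl

  χ-other : ∀ {x v} → v ≢ x → χ x v ≡ 0ℤ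
  χ-other {x} {v} = if-no (v ≟ x)

  χ-sym : ∀ x v → χ x v ≡ χ v x
  χ-sym x v = if-cong (v ≟ x) (x ≟ v) sym sym

  0≤χ : ∀ x v → 0ℤ ≤ χ x v
  0≤χ x v with v ≟ x
  ... | yes _ = +≤+ z≤n
  ... | no  _ = ℤ.≤-refl

  deg-χ : ∀ x → deg (χ x) ≡ 1ℤ
  deg-χ x = ∑-single (const 1ℤ) x

  -- Symmetry of the Laplacian matrix: an edge st contributes (χ v s - χ v t)(χ x s - χ x t). It
  -- lets the effect of firing x on every vertex be read off from the Laplacian at x alone.
  div-χ-sym : ∀ x v → div (χ x) v ≡ div (χ v) x
  div-χ-sym x v = sum-cong-≗ λ e → begin
    slope (χ x) v (src G e) (tgt G e) + slope (χ x) v (tgt G e) (src G e)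
      ≡⟨ cong₂ _+_ (slope-χ x v (src G e) (tgt G e)) (slope-χ x v (tgt G e) (src G e)) ⟩
    χ v (src G e) * (χ x (src G e) - χ x (tgt G e)) + χ v (tgt G e) * (χ x (tgt G e) - χ x (src G e))
      ≡⟨ exchange (χ v (src G e)) (χ x (src G e)) (χ x (tgt G e)) (χ v (tgt G e)) ⟩
    χ x (src G e) * (χ v (src G e) - χ v (tgt G e)) + χ x (tgt G e) * (χ v (tgt G e) - χ v (src G e))
      ≡⟨ cong₂ _+_ (slope-χ v x (src G e) (tgt G e)) (slope-χ v x (tgt G e) (src G e)) ⟨
    slope (χ v) x (src G e) (tgt G e) + slope (χ v) x (tgt G e) (src G e) ∎
    where
    open ≡-Reasoning
    exchange : ∀ a b c d → a * (b - c) + d * (c - b) ≡ b * (a - d) + c * (d - a)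
    exchange = solve-∀
    slope-χ : ∀ x v s t → slope (χ x) v s t ≡ χ v s * (χ x s - χ x t)
    slope-χ x v s t with v ≟ s
    ... | yes refl = sym (trans (cong (_* (χ x v - χ x t)) (χ-self v)) (ℤ.*-identityˡ _))
    ... | no v≢s   = sym (cong (_* (χ x s - χ x t)) (χ-other (v≢s ∘ sym)))

  -- Solvability and principal divisors

  Solvable : Div G → Set
  Solvable D = ∃[ f ] Winning D f

  solvable-≗ : ∀ {D D′ : Div G} → (∀ v → D v ≡ D′ v) → Solvable D → Solvable D′
  solvable-≗ D≗D′ (f , win) = f , λ v → subst (λ x → 0ℤ ≤ x + div f v) (D≗D′ v) (win v)

  ¬solvable⇒empty : ∀ {D} → ¬ Solvable D → Empty ∥ D ∥
  ¬solvable⇒empty {D} ¬s E E∈ = ¬s (satisfiable⇒winning D (E , E∈))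

  empty⇒¬solvable : ∀ {D} → Empty ∥ D ∥ → ¬ Solvable D
  empty⇒¬solvable {D} em s = let E , E∈ = winning⇒satisfiable D s in em E E∈

  Principal : Div G → Set
  Principal D = ∃[ f ] (∀ v → D v ≡ div f v)

  principal-cong : ∀ {D D′ : Div G} → (∀ v → D v ≡ D′ v) → Principal D → Principal D′
  principal-cong D≗D′ (f , eq) = f , λ v → trans (sym (D≗D′ v)) (eq v)

  principal-- : ∀ {D D′ : Div G} → Principal D → Principal D′ → Principal (D -ᴰ D′)
  principal-- (f , f-eq) (g , g-eq) =
    (λ w → f w - g w) , λ v → trans (cong₂ _-_ (f-eq v) (g-eq v)) (sym (div-- f g v))

  principal-0 : Principal (const 0ℤ)
  principal-0 = principal-cong {div (const 0ℤ) -ᴰ div (const 0ℤ)} (λ v → ℤ.+-inverseʳ (div (const 0ℤ) v))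
    (principal-- z z)
    where
    z : Principal (div (const 0ℤ))
    z = const 0ℤ , λ _ → refl

  effective-take : ∀ D → Effective D → ∀ {x} → 1ℤ ≤ D x → Effective (D -ᴰ χ x)
  effective-take D D≥0 {x} chip v with v ≟ x
  ... | yes refl = ℤ.i≤j⇒0≤j-i chip
  ... | no  _    = subst (0ℤ ≤_) (sym (ℤ.+-identityʳ (D v))) (D≥0 v)

  exchange-χ : ∀ b c d → (b - c) + d ≡ (b + d) - c
  exchange-χ = solve-∀

  -- Together with `winning-untake` and `chip-untake`, this trades a solution for D - (x) for a
  -- function that is winning for D and leaves a chip at x; in that form solutions for different x
  -- can be combined by minima.
  solvable-take : ∀ D f → Winning D f → ∀ {x} → 1ℤ ≤ D x + div f x → Solvable (D -ᴰ χ x)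
  solvable-take D f win {x} chip = f , λ v → subst (0ℤ ≤_) (sym (exchange-χ (D v) (χ x v) (div f v)))
    (effective-take (λ v → D v + div f v) win chip v)

  winning-untake : ∀ D f {x} → Winning (D -ᴰ χ x) f → Winning D f
  winning-untake D f {x} win v = subst (0ℤ ≤_) (restore (D v) (χ x v) (div f v)) (0≤+ (win v) (0≤χ x v))
    where
    restore : ∀ b c d → ((b - c) + d) + c ≡ b + d
    restore = solve-∀

  chip-untake : ∀ D f {x} → Winning (D -ᴰ χ x) f → 1ℤ ≤ D x + div f x
  chip-untake D f {x} win = ≤-by (win x) (trans (exchange-χ (D x) (χ x x) (div f x))
    (cong (λ c → (D x + div f x) - c) (χ-self x)))

minimum-unique : ∀ {P Q : Pred ℤ 0ℓ} {d d′} → P ⊆ Q → Q ⊆ P → IsMinimum P d → IsMinimum Q d′ → d ≡ d′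
minimum-unique P⊆Q Q⊆P (d∈P , d-least) (d′∈Q , d′-least) =
  ℤ.≤-antisym (d-least _ (Q⊆P d′∈Q)) (d′-least _ (P⊆Q d∈P))

-- Divisors on a subdivision

-- Numbers beyond n are sent to the last element.
clamp : ∀ {n} → ℕ → Fin (ℕ.suc n)
clamp           ℕ.zero    = zero
clamp {ℕ.zero}  (ℕ.suc _) = zero
clamp {ℕ.suc n} (ℕ.suc i) = suc (clamp i)

clamp-toℕ : ∀ {n} (i : Fin (ℕ.suc n)) → clamp (toℕ i) ≡ i
clamp-toℕ           zero    = refl
clamp-toℕ {ℕ.suc n} (suc i) = cong suc (clamp-toℕ i)

toℕ-clamp : ∀ {n i} → i ℕ.≤ n → toℕ (clamp {n} i) ≡ i
toℕ-clamp           z≤n       = refl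
toℕ-clamp {ℕ.suc n} (s≤s i≤n) = cong ℕ.suc (toℕ-clamp i≤n)

clamp-≡ : ∀ {n i} (j : Fin (ℕ.suc n)) → toℕ j ≡ i → clamp i ≡ j
clamp-≡ j refl = clamp-toℕ j

module _ (k : ℕ) (G : Graph) where
  open Subdivision k G

  H : Graph
  H = subdivide k G

  module G = Divisors G
  module H = Divisors H

  -- Positions on the paths

  old-injective : ∀ {u v} → old u ≡ old v → u ≡ v
  old-injective = ↑ˡ-injective _ _ _

  old≢inner : ∀ {u e i} → old u ≢ inner e i
  old≢inner {u} {e} {i} eq
    with trans (sym (splitAt-↑ˡ (#V G) u _)) (trans (cong (splitAt (#V G)) eq) (splitAt-↑ʳ (#V G) _ (combine e i)))
  ... | ()

  path-inner⁻¹ : ∀ {e i} e′ a → path e′ a ≡ inner e i → e′ ≡ e × a ≡ suc (inject₁ i)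
  path-inner⁻¹ e′ zero eq = ⊥-elim (old≢inner eq)
  path-inner⁻¹ {e} {i} e′ (suc b) eq with view b
  ... | ‵fromℕ     = ⊥-elim (old≢inner eq)
  ... | ‵inject₁ j with combine-injective e′ j e i (↑ʳ-injective (#V G) _ _ eq)
  ... | refl , refl = refl , refl

  path-old⁻¹ : ∀ {u} e a → path e a ≡ old u →
               (a ≡ zero × src G e ≡ u) ⊎ (a ≡ fromℕ (ℕ.suc k) × tgt G e ≡ u)
  path-old⁻¹ e zero eq = inj₁ (refl , old-injective eq)
  path-old⁻¹ e (suc b) eq with view b
  ... | ‵fromℕ     = inj₂ (refl , old-injective eq)
  ... | ‵inject₁ j = ⊥-elim (old≢inner (sym eq))

  -- Inner vertices occur only once, so the only possible coincidence is that of the two ends, which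
  -- the hypothesis on e excludes.
  path-injective : ∀ e → src G e ≢ tgt G e → ∀ a b → path e a ≡ path e b → a ≡ b
  path-injective e s≢t a zero eq with path-old⁻¹ e a eq
  ... | inj₁ (a≡0 , _) = a≡0
  ... | inj₂ (_ , t≡s) = ⊥-elim (s≢t (sym t≡s))
  path-injective e s≢t a (suc b) eq with view b
  ... | ‵inject₁ j = proj₂ (path-inner⁻¹ e a eq)
  ... | ‵fromℕ with path-old⁻¹ e a eq
  ... | inj₁ (_ , s≡t) = ⊥-elim (s≢t s≡t)
  ... | inj₂ (a≡k , _) = a≡k

  -- The n-th vertex on the path replacing e, for n ≤ k + 1.
  at : Edge G → ℕ → Vertex H
  at e n = path e (clamp n)

  at-last : ∀ e → at e (ℕ.suc k) ≡ old (tgt G e)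
  at-last e = trans (cong (path e) (clamp-≡ (fromℕ (ℕ.suc k)) (toℕ-fromℕ _))) (path-last e)

  at-inner : ∀ e i → at e (ℕ.suc (toℕ i)) ≡ inner e i
  at-inner e i = trans (cong (path e) (clamp-≡ (suc (inject₁ i)) (cong ℕ.suc (toℕ-inject₁ i)))) (path-inner e i)

  at-injective : ∀ e → src G e ≢ tgt G e → ∀ {m n} → m ℕ.≤ ℕ.suc k → n ℕ.≤ ℕ.suc k →
                 at e m ≡ at e n → m ≡ n
  at-injective e s≢t m≤ n≤ eq =
    trans (sym (toℕ-clamp m≤)) (trans (cong toℕ (path-injective e s≢t _ _ eq)) (toℕ-clamp n≤))

  -- The Laplacian of the subdivision

  module _ (F : Vertex H → ℤ) (v : Vertex H) where

    fwd bwd : Edge G → Fin (ℕ.suc k) → ℤ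
    fwd e j = H.slope F v (path e (inject₁ j)) (path e (suc j))
    bwd e j = H.slope F v (path e (suc j)) (path e (inject₁ j))

    fwd-0 : ∀ e j → path e (inject₁ j) ≢ v → fwd e j ≡ 0ℤ
    fwd-0 e j ≢v = if-no (v ≟ path e (inject₁ j)) (≢v ∘ sym)

    bwd-0 : ∀ e j → path e (suc j) ≢ v → bwd e j ≡ 0ℤ
    bwd-0 e j ≢v = if-no (v ≟ path e (suc j)) (≢v ∘ sym)

    -- After splitting by direction, each sum over a path has at most one nonzero term: no two of
    -- its steps start at the same vertex, and no two end at the same vertex.
    div-subdivide : H.div F v ≡ ∑[ e < #E G ] (sum (fwd e) + sum (bwd e))
    div-subdivide = trans (∑-combine (#E G) {ℕ.suc k} _) (sum-cong-≗ λ e → trans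
      (sum-cong-≗ λ j → cong (λ (e , j) → fwd e j + bwd e j) (remQuot-combine e j))
      (∑-distrib-+ (fwd e) (bwd e)))

  -- An inner vertex lies on one path only, where one step leaves it and one enters it.
  div-inner : ∀ F e i → let n = toℕ i in
    H.div F (at e (ℕ.suc n)) ≡
    (F (at e (ℕ.suc n)) - F (at e (ℕ.suc (ℕ.suc n)))) + (F (at e (ℕ.suc n)) - F (at e n))
  div-inner F e i = begin
    H.div F v
      ≡⟨ div-subdivide F v ⟩
    ∑[ e < #E G ] (sum (fwd F v e) + sum (bwd F v e))
      ≡⟨ ∑-only _ e (λ e′ e′≢e → cong₂ _+_
           (∑-zero λ j → fwd-0 F v e′ j (e′≢e ∘ proj₁ ∘ on-path e′ (inject₁ j)))
           (∑-zero λ j → bwd-0 F v e′ j (e′≢e ∘ proj₁ ∘ on-path e′ (suc j)))) ⟩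
    sum (fwd F v e) + sum (bwd F v e)
      ≡⟨ cong₂ _+_
           (∑-only (fwd F v e) (suc i) λ j j≢ → fwd-0 F v e j (j≢ ∘ inject₁-injective ∘ proj₂ ∘ on-path e _))
           (∑-only (bwd F v e) (inject₁ i) λ j j≢ → bwd-0 F v e j (j≢ ∘ suc-injective ∘ proj₂ ∘ on-path e _)) ⟩
    fwd F v e (suc i) + bwd F v e (inject₁ i)
      ≡⟨ cong₂ _+_ (if-yes (v ≟ _) here) (if-yes (v ≟ _) here) ⟩
    (F v - F (path e (suc (suc i)))) + (F v - F (path e (inject₁ (inject₁ i))))
      ≡⟨ cong₂ (λ a b → (F v - F (path e a)) + (F v - F (path e b)))
           (sym (clamp-≡ (suc (suc i)) refl))
           (sym (clamp-≡ (inject₁ (inject₁ i)) (trans (toℕ-inject₁ _) (toℕ-inject₁ i)))) ⟩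
    (F v - F (at e (ℕ.suc (ℕ.suc (toℕ i))))) + (F v - F (at e (toℕ i))) ∎
    where
    open ≡-Reasoning
    v : Vertex H
    v = at e (ℕ.suc (toℕ i))
    here : v ≡ path e (suc (inject₁ i))
    here = trans (at-inner e i) (sym (path-inner e i))
    on-path : ∀ e′ a → path e′ a ≡ v → e′ ≡ e × a ≡ suc (inject₁ i)
    on-path e′ a eq = path-inner⁻¹ e′ a (trans eq (at-inner e i))

  div-inner-ℕ : ∀ F e {n} → n ℕ.< k → H.div F (at e (ℕ.suc n)) ≡
    (F (at e (ℕ.suc n)) - F (at e (ℕ.suc (ℕ.suc n)))) + (F (at e (ℕ.suc n)) - F (at e n))
  div-inner-ℕ F e n<k = subst
    (λ n → H.div F (at e (ℕ.suc n)) ≡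
      (F (at e (ℕ.suc n)) - F (at e (ℕ.suc (ℕ.suc n)))) + (F (at e (ℕ.suc n)) - F (at e n)))
    (toℕ-fromℕ< n<k) (div-inner F e (fromℕ< n<k))

  -- On each path, only the first step can start at an old vertex and only the last can end at one.
  div-old : ∀ F u → H.div F (old u) ≡
    ∑[ e < #E G ] ((if does (u ≟ src G e) then F (old u) - F (at e 1) else 0ℤ)
                 + (if does (u ≟ tgt G e) then F (old u) - F (at e k) else 0ℤ))
  div-old F u = trans (div-subdivide F v) (sum-cong-≗ λ e → cong₂ _+_ (fwd-sum e) (bwd-sum e))
    where
    v : Vertex H
    v = old u
    fwd-sum : ∀ e → sum (fwd F v e) ≡ (if does (u ≟ src G e) then F v - F (at e 1) else 0ℤ)
    fwd-sum e = trans
      (∑-only (fwd F v e) zero λ j j≢0 → fwd-0 F v e j λ eq → case-fwd j j≢0 (path-old⁻¹ e (inject₁ j) eq))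
      (if-cong (v ≟ old (src G e)) (u ≟ src G e) old-injective (cong old))
      where
      case-fwd : ∀ j → j ≢ zero →
                 ¬ ((inject₁ j ≡ zero × src G e ≡ u) ⊎ (inject₁ j ≡ fromℕ (ℕ.suc k) × tgt G e ≡ u))
      case-fwd j j≢0 (inj₁ (eq , _)) = j≢0 (inject₁-injective eq)
      case-fwd j j≢0 (inj₂ (eq , _)) = fromℕ≢inject₁ (sym eq)
    bwd-sum : ∀ e → sum (bwd F v e) ≡ (if does (u ≟ tgt G e) then F v - F (at e k) else 0ℤ)
    bwd-sum e = trans
      (∑-only (bwd F v e) (fromℕ k) λ j j≢k → bwd-0 F v e j λ eq → case-bwd j j≢k (path-old⁻¹ e (suc j) eq))
      (trans
        (cong (λ a → if does (v ≟ path e (suc (fromℕ k))) then F v - F (path e a) else 0ℤ)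
          (sym (clamp-≡ (inject₁ (fromℕ k)) (trans (toℕ-inject₁ _) (toℕ-fromℕ k)))))
        (if-cong (v ≟ path e (suc (fromℕ k))) (u ≟ tgt G e)
          (λ eq → old-injective (trans eq (path-last e)))
          (λ eq → trans (cong old eq) (sym (path-last e)))))
      where
      case-bwd : ∀ j → j ≢ fromℕ k →
                 ¬ ((suc j ≡ zero × src G e ≡ u) ⊎ (suc j ≡ fromℕ (ℕ.suc k) × tgt G e ≡ u))
      case-bwd j j≢k (inj₁ (() , _))
      case-bwd j j≢k (inj₂ (eq , _)) = j≢k (suc-injective eq)

  -- Extension of divisors

  extend-old : ∀ (D : Div G) v → extend k G D (old v) ≡ D v
  extend-old D v = cong [ D , const 0ℤ ]′ (splitAt-↑ˡ (#V G) v _)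

  extend-inner : ∀ (D : Div G) e i → extend k G D (inner e i) ≡ 0ℤ
  extend-inner D e i = cong [ D , const 0ℤ ]′ (splitAt-↑ʳ (#V G) _ (combine e i))

  extend-at-inner : ∀ (D : Div G) e i → extend k G D (at e (ℕ.suc (toℕ i))) ≡ 0ℤ
  extend-at-inner D e i = trans (cong (extend k G D) (at-inner e i)) (extend-inner D e i)

  -- Inner vertices are presented as positions on a path because `div-inner` computes the Laplacian
  -- in that form.
  vertex-elim : ∀ (P : Vertex H → Set) → (∀ v → P (old v)) → (∀ e i → P (at e (ℕ.suc (toℕ i)))) → ∀ v → P v
  vertex-elim P o p v = subst P (join-splitAt (#V G) _ v) (go (splitAt (#V G) v))
    where
    go : ∀ s → P (join (#V G) (#E G ℕ.* k) s)
    go (inj₁ u) = o u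
    go (inj₂ y) = subst P
      (trans (at-inner _ _) (cong (#V G ↑ʳ_) (combine-remQuot {#E G} k y)))
      (p (proj₁ (remQuot {#E G} k y)) (proj₂ (remQuot {#E G} k y)))

  -- Interpolation of functions on the original graph

  module _ (f : Vertex G → ℤ) where

    -- The factor k + 1 clears denominators: the rise of (k + 1) f along an edge is spread evenly
    -- over k + 1 unit steps.
    between : Edge G → ℕ → ℤ
    between e n = + ℕ.suc k * f (src G e) + + n * (f (tgt G e) - f (src G e))

    interpolate : Vertex H → ℤ
    interpolate v = [ (λ u → + ℕ.suc k * f u)
                    , (λ y → let e , i = remQuot {#E G} k y in between e (ℕ.suc (toℕ i)))
                    ]′ (splitAt (#V G) v)

    interpolate-old : ∀ u → interpolate (old u) ≡ + ℕ.suc k * f u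
    interpolate-old u = cong [ _ , _ ]′ (splitAt-↑ˡ (#V G) u _)

    interpolate-inner : ∀ e i → interpolate (inner e i) ≡ between e (ℕ.suc (toℕ i))
    interpolate-inner e i = trans (cong [ _ , _ ]′ (splitAt-↑ʳ (#V G) _ (combine e i)))
      (cong (λ (e , i) → between e (ℕ.suc (toℕ i))) (remQuot-combine e i))

    interpolate-at : ∀ e {n} → n ℕ.≤ ℕ.suc k → interpolate (at e n) ≡ between e n
    interpolate-at e {ℕ.zero} _ = trans (interpolate-old (src G e))
      (pad (+ ℕ.suc k * f (src G e)) (f (tgt G e) - f (src G e)))
      where
      pad : ∀ a d → a ≡ a + 0ℤ * d
      pad = solve-∀
    interpolate-at e {ℕ.suc n} (s≤s n≤k) with ℕ.m≤n⇒m<n∨m≡n n≤k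
    ... | inj₂ refl = trans (cong interpolate (at-last e)) (trans (interpolate-old (tgt G e))
      (full (+ ℕ.suc k) (f (src G e)) (f (tgt G e))))
      where
      full : ∀ m s t → m * t ≡ m * s + m * (t - s)
      full = solve-∀
    ... | inj₁ n<k = subst (λ n → interpolate (at e (ℕ.suc n)) ≡ between e (ℕ.suc n)) (toℕ-fromℕ< n<k)
      (trans (cong interpolate (at-inner e (fromℕ< n<k))) (interpolate-inner e (fromℕ< n<k)))

    between-step : ∀ e n → between e (ℕ.suc n) ≡ between e n + (f (tgt G e) - f (src G e))
    between-step e n = step (+ ℕ.suc k * f (src G e)) (+ n) (f (tgt G e) - f (src G e))
      where
      step : ∀ a n d → a + (1ℤ + n) * d ≡ a + n * d + d
      step = solve-∀

    -- The constant increment yields both facts about the Laplacian of `interpolate`: at an old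
    -- vertex the slopes are those of f, and at an inner vertex they cancel.
    interpolate-step : ∀ e {n} → n ℕ.≤ k →
      interpolate (at e (ℕ.suc n)) ≡ interpolate (at e n) + (f (tgt G e) - f (src G e))
    interpolate-step e {n} n≤k = trans (interpolate-at e (s≤s n≤k)) (trans (between-step e n)
      (cong (λ x → x + (f (tgt G e) - f (src G e))) (sym (interpolate-at e (ℕ.m≤n⇒m≤1+n n≤k)))))

    div-interpolate-old : ∀ u → G.div f u ≤ H.div interpolate (old u)
    div-interpolate-old u = subst (G.div f u ≤_) (sym (div-old interpolate u))
      (∑-mono-≤ {s = flow G f u} λ e → ℤ.+-mono-≤
        (if-mono (u ≟ src G e) λ { refl → ℤ.≤-reflexive (sym (trans
          (cong (λ x → interpolate (old u) - x) (interpolate-step e z≤n))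
          (at-src (interpolate (old u)) (f u) (f (tgt G e))))) })
        (if-mono (u ≟ tgt G e) λ { refl → ℤ.≤-reflexive (sym (trans
          (cong (λ x → x - interpolate (at e k))
            (trans (cong interpolate (sym (at-last e))) (interpolate-step e ℕ.≤-refl)))
          (at-tgt (interpolate (at e k)) (f (src G e)) (f u)))) }))
      where
      at-src : ∀ x s t → x - (x + (t - s)) ≡ s - t
      at-src = solve-∀
      at-tgt : ∀ x s t → (x + (t - s)) - x ≡ t - s
      at-tgt = solve-∀

    div-interpolate-inner : ∀ e i → H.div interpolate (at e (ℕ.suc (toℕ i))) ≡ 0ℤ
    div-interpolate-inner e i = begin
      H.div interpolate (at e (ℕ.suc (toℕ i)))
        ≡⟨ div-inner interpolate e i ⟩
      (y - z) + (y - x)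
        ≡⟨ cong₂ (λ y z → (y - z) + (y - x)) y≡ (trans (interpolate-step e (toℕ<n i)) (cong (λ y → y + d) y≡)) ⟩
      ((x + d) - (x + d + d)) + ((x + d) - x)
        ≡⟨ cancel x d ⟩
      0ℤ ∎
      where
      open ≡-Reasoning
      x y z d : ℤ
      x = interpolate (at e (toℕ i))
      y = interpolate (at e (ℕ.suc (toℕ i)))
      z = interpolate (at e (ℕ.suc (ℕ.suc (toℕ i))))
      d = f (tgt G e) - f (src G e)
      y≡ : y ≡ x + d
      y≡ = interpolate-step e (ℕ.<⇒≤ (toℕ<n i))
      cancel : ∀ x d → ((x + d) - (x + d + d)) + ((x + d) - x) ≡ 0ℤ
      cancel = solve-∀

  solvable-extend : ∀ {D} → Solvable G D → Solvable H (extend k G D)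
  solvable-extend {D} (f , win) = interpolate f , vertex-elim _
    (λ u → ℤ.≤-trans (win u)
      (ℤ.+-mono-≤ (ℤ.≤-reflexive (sym (extend-old D u))) (div-interpolate-old f u)))
    (λ e i → ℤ.≤-reflexive (sym (cong₂ _+_
      (extend-at-inner D e i) (div-interpolate-inner f e i))))

  -- The first step of F from an old vertex is, by concavity, at most 1 / (k + 1)
  -- of the total drop; being an integer, it stays below the drop of ⌊F / (k + 1)⌋.
  solvable-restrict : ∀ {D} → Solvable H (extend k G D) → Solvable G D
  solvable-restrict {D} (F , win) = f , λ u → ℤ.≤-trans (win (old u))
    (ℤ.+-mono-≤ (ℤ.≤-reflexive (extend-old D u)) (subst (_≤ G.div f u) (sym (div-old F u))
      (∑-mono-≤ {t = flow G f u} λ e → ℤ.+-mono-≤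
        (if-mono (u ≟ src G e) λ { refl → /ℕ-difference (ℕ.suc k) _ (F (old u)) (F (old (tgt G e)))
          (subst (λ v → + ℕ.suc k * (F (old u) - F (at e 1)) ≤ F (old u) - F v) (at-last e)
            (first-slope (F ∘ at e) (concave e))) })
        (if-mono (u ≟ tgt G e) λ { refl → /ℕ-difference (ℕ.suc k) _ (F (old u)) (F (old (src G e)))
          (subst (λ v → + ℕ.suc k * (F v - F (at e k)) ≤ F v - F (old (src G e))) (at-last e)
            (last-slope (F ∘ at e) (concave e))) }))))
    where
    f : Vertex G → ℤ
    f u = F (old u) /ℕ ℕ.suc k
    -- The extended divisor vanishes at inner vertices, so winning there says exactly that the
    -- Laplacian is nonnegative, which is concavity along the path.
    concave : ∀ e → Concave k (F ∘ at e)
    concave e n n<k = subst (λ n → 0ℤ ≤ (F (at e (ℕ.suc n)) - F (at e (ℕ.suc (ℕ.suc n)))) + (F (at e (ℕ.suc n)) - F (at e n)))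
      (toℕ-fromℕ< n<k)
      (subst (0ℤ ≤_) (trans
        (cong₂ _+_ (extend-at-inner D e i) (div-inner F e i))
        (ℤ.+-identityˡ _)) (win (at e (ℕ.suc (toℕ i)))))
      where
      i : Fin k
      i = fromℕ< n<k

  -- All unit steps along a subdivided edge are equivalent, because firing an
  -- inner vertex exchanges the two steps at that vertex.
  module _ (e : Edge G) where

    δ : ℕ → Div H
    δ n v = χ H (at e (ℕ.suc n)) v - χ H (at e n) v

    δ-principal : ∀ n → n ℕ.≤ k → Principal H (λ v → δ n v - δ 0 v)
    δ-principal ℕ.zero n≤k =
      principal-cong H (λ v → sym (ℤ.+-inverseʳ (δ 0 v))) (principal-0 H)
    -- Subtract from δ n - δ 0 the divisor δ n - δ (n + 1) that firing `x` produces.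
    δ-principal (ℕ.suc n) n<k = principal-cong H
      (λ v → telescope (δ n v) (δ 0 v) (δ (ℕ.suc n) v))
      (principal-- H (δ-principal n (ℕ.<⇒≤ n<k)) (χ H x , fire))
      where
      x : Vertex H
      x = at e (ℕ.suc n)
      telescope : ∀ a b c → (a - b) - (a - c) ≡ c - b
      telescope = solve-∀
      regroup : ∀ p q r → (q - r) + (q - p) ≡ (q - p) - (r - q)
      regroup = solve-∀
      fire : ∀ v → δ n v - δ (ℕ.suc n) v ≡ H.div (χ H x) v
      fire v = sym (begin
        H.div (χ H x) v
          -- Symmetry moves the evaluation from the arbitrary v to the inner vertex `x`, where the
          -- formula is known.
          ≡⟨ div-χ-sym H x v ⟩
        H.div (χ H v) x
          ≡⟨ div-inner-ℕ (χ H v) e n<k ⟩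
        (χ H v x - χ H v (at e (ℕ.suc (ℕ.suc n)))) + (χ H v x - χ H v (at e n))
          ≡⟨ regroup (χ H v (at e n)) (χ H v x) (χ H v (at e (ℕ.suc (ℕ.suc n)))) ⟩
        (χ H v x - χ H v (at e n)) - (χ H v (at e (ℕ.suc (ℕ.suc n))) - χ H v x)
          ≡⟨ cong₂ _-_ (cong₂ _-_ (χ-sym H v x) (χ-sym H v (at e n)))
                       (cong₂ _-_ (χ-sym H v (at e (ℕ.suc (ℕ.suc n)))) (χ-sym H v x)) ⟩
        δ n v - δ (ℕ.suc n) v ∎)
        where open ≡-Reasoning

    pair : ℕ → ℕ → Div H
    pair i j v = χ H (at e i) v + χ H (at e j) v

    -- Chips at i and n + j turn into chips at n + i and j. Each of the n rounds moves one chip a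
    -- step forward and the other a step back, which balances by `δ-principal`.
    pair-principal : ∀ n i j → n ℕ.+ i ℕ.≤ ℕ.suc k → n ℕ.+ j ℕ.≤ ℕ.suc k →
                     Principal H (λ v → pair (n ℕ.+ i) j v - pair i (n ℕ.+ j) v)
    pair-principal ℕ.zero i j _ _ =
      principal-cong H (λ v → sym (ℤ.+-inverseʳ (pair i j v))) (principal-0 H)
    pair-principal (ℕ.suc n) i j (s≤s ni≤k) (s≤s nj≤k) = principal-cong H
      (λ v → regroup (χ H (at e (ℕ.suc n ℕ.+ i)) v) (χ H (at e (n ℕ.+ i)) v) (χ H (at e i) v)
                     (χ H (at e (ℕ.suc n ℕ.+ j)) v) (χ H (at e (n ℕ.+ j)) v) (χ H (at e j) v) (δ 0 v))
      (principal-- H (pair-principal n i j (ℕ.m≤n⇒m≤1+n ni≤k) (ℕ.m≤n⇒m≤1+n nj≤k))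
        (principal-- H (δ-principal (n ℕ.+ j) nj≤k) (δ-principal (n ℕ.+ i) ni≤k)))
      where
      regroup : ∀ i₂ i₁ i₀ j₂ j₁ j₀ s →
        ((i₁ + j₀) - (i₀ + j₁)) - (((j₂ - j₁) - s) - ((i₂ - i₁) - s)) ≡ (i₂ + j₀) - (i₀ + j₂)
      regroup = solve-∀

  -- Chips at inner vertices

  module _ (B : Div H) (e : Edge G) (s≢t : src G e ≢ tgt G e) where

    -- Two chips on a subdivided edge can move towards each other until one of
    -- them reaches a given vertex between them.
    solvable-between : ∀ f → H.Winning B f → ∀ {y i z} → y ℕ.≤ i → i ℕ.≤ z → z ℕ.≤ ℕ.suc k →
      1ℤ ≤ B (at e y) + H.div f (at e y) → 1ℤ ≤ B (at e z) + H.div f (at e z) →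
      Solvable H (B H.-ᴰ χ H (at e i))
    solvable-between f win {y} {i} {z} y≤i i≤z z≤m chip-y chip-z with y ℕ.≟ z
    -- If y = z the two chips may be the same one, but then i = y and it is already in place.
    ... | yes refl with ℕ.≤-antisym y≤i i≤z
    ... | refl = solvable-take H B f win chip-y
    solvable-between f win {y} {i} {z} y≤i i≤z z≤m chip-y chip-z | no y≢z =
      (λ w → f w - h w) , λ v → subst (0ℤ ≤_) (sym (begin
        B v - χ H (at e i) v + H.div (λ w → f w - h w) v
          ≡⟨ cong (λ d → B v - χ H (at e i) v + d) (trans (div-- H f h v) (cong (λ d → H.div f v - d) (sym (h-div v)))) ⟩
        B v - χ H (at e i) v + (H.div f v - (pair e y z v - pair e i j v))
          ≡⟨ regroup (B v) (χ H (at e i) v) (H.div f v) (χ H (at e y) v) (χ H (at e z) v) (χ H (at e j) v) ⟩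
        (B v + H.div f v - χ H (at e y) v - χ H (at e z) v) + χ H (at e j) v ∎))
        -- The chips at y and z can be taken in turn because they lie at distinct vertices; the chip
        -- arriving at j is surplus.
        (0≤+ (effective-take H (λ v → B v + H.div f v - χ H (at e y) v)
               (effective-take H (λ v → B v + H.div f v) win chip-y)
               (subst (1ℤ ≤_) (sym (no-chip (B (at e z) + H.div f (at e z)))) chip-z) v)
             (0≤χ H (at e j) v))
      where
      open ≡-Reasoning
      -- The chip at y advances n steps to i, so the one at z retreats n steps to j.
      n j : ℕ
      n = i ℕ.∸ y
      j = z ℕ.∸ n
      n+y≡i : n ℕ.+ y ≡ i
      n+y≡i = ℕ.m∸n+n≡m y≤i
      n≤z : n ℕ.≤ z
      n≤z = ℕ.≤-trans (ℕ.m∸n≤m i y) i≤z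
      n+j≡z : n ℕ.+ j ≡ z
      n+j≡z = ℕ.m+[n∸m]≡n n≤z
      moved : Principal H (λ v → pair e y z v - pair e i j v)
      moved = principal-cong H
        (λ v → trans (negate (pair e (n ℕ.+ y) j v) (pair e y (n ℕ.+ j) v))
          (cong₂ (λ i z → pair e y z v - pair e i j v) n+y≡i n+j≡z))
        (principal-- H (principal-0 H) (pair-principal e n y j
          (subst (ℕ._≤ ℕ.suc k) (sym n+y≡i) (ℕ.≤-trans i≤z z≤m))
          (subst (ℕ._≤ ℕ.suc k) (sym n+j≡z) z≤m)))
        where
        negate : ∀ a b → 0ℤ - (a - b) ≡ b - a
        negate = solve-∀
      h : Vertex H → ℤ
      h = proj₁ moved
      h-div : ∀ v → pair e y z v - pair e i j v ≡ H.div h v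
      h-div = proj₂ moved
      no-chip : ∀ c → c - χ H (at e y) (at e z) ≡ c
      no-chip c = trans (cong (λ x → c - x) (χ-other H λ eq →
        y≢z (sym (at-injective e s≢t z≤m (ℕ.≤-trans y≤i (ℕ.≤-trans i≤z z≤m)) eq)))) (ℤ.+-identityʳ c)
      regroup : ∀ b χi d χy χz χj →
        b - χi + (d - ((χy + χz) - (χi + χj))) ≡ (b + d - χy - χz) + χj
      regroup = solve-∀

    solvable-inner : ∀ {p} → p ℕ.< k →
      Solvable H (B H.-ᴰ χ H (old (src G e))) → Solvable H (B H.-ᴰ χ H (old (tgt G e))) →
      Solvable H (B H.-ᴰ χ H (at e (ℕ.suc p)))
    solvable-inner {p} p<k (f , win-f) (a , win-a) =
      -- The searches ask for a second chip across `x`: b already has one at the start of the path,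
      -- and a has one at its end. Both ranges include `x` itself.
      decide (ℕ.anyUpTo? (λ n → (i ℕ.≤? n) ×-dec (1ℤ ℤ.≤? chips b (at e n))) (ℕ.suc m))
             (ℕ.anyUpTo? (λ n → 1ℤ ℤ.≤? chips a (at e n)) (ℕ.suc i))
      where
      i m : ℕ
      i = ℕ.suc p
      m = ℕ.suc k
      i≤m : i ℕ.≤ m
      i≤m = ℕ.m≤n⇒m≤1+n p<k
      x : Vertex H
      x = at e i
      chips : (Vertex H → ℤ) → Div H
      chips g v = B v + H.div g v
      -- Normalised so that a and b agree at x.
      b : Vertex H → ℤ
      b v = f v + (a x - f x)
      div-b : ∀ v → H.div f v ≡ H.div b v
      div-b = H.div-cong f b λ v w → shift (f v) (f w) (a x - f x)
        where
        shift : ∀ p q c → p - q ≡ (p + c) - (q + c)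
        shift = solve-∀
      chips-b : ∀ v → chips f v ≡ chips b v
      chips-b v = cong (λ d → B v + d) (div-b v)
      win-f′ : H.Winning B f
      win-f′ = winning-untake H B f win-f
      win-b : H.Winning B b
      win-b v = subst (0ℤ ≤_) (chips-b v) (win-f′ v)
      win-a′ : H.Winning B a
      win-a′ = winning-untake H B a win-a
      chip-b : 1ℤ ≤ chips b (at e 0)
      chip-b = subst (1ℤ ≤_) (chips-b _) (chip-untake H B f win-f)
      chip-a : 1ℤ ≤ chips a (at e m)
      chip-a = subst (λ v → 1ℤ ≤ chips a v) (sym (at-last e)) (chip-untake H B a win-a)

      min : Vertex H → ℤ
      min v = a v ⊓ b v
      win-min : H.Winning B min
      win-min = winning-⊓ H B a b win-a′ win-b

      -- The sign of `F` at a position tells which of a and b realises the minimum there.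
      F : ℕ → ℤ
      F n = a (at e n) - b (at e n)
      F-i : F i ≡ 0ℤ
      F-i = cancel (a x) (f x)
        where
        cancel : ∀ p q → p - (q + (p - q)) ≡ 0ℤ
        cancel = solve-∀

      -- `B` cancels, leaving the Laplacian of a - b, which at an inner vertex is the negated second
      -- difference of `F`.
      chips-difference : ∀ n → n ℕ.< k →
        chips a (at e (ℕ.suc n)) - chips b (at e (ℕ.suc n)) ≡ increment F n - increment F (ℕ.suc n)
      chips-difference n n<k = trans
        (cong₂ (λ p q → (B (at e (ℕ.suc n)) + p) - (B (at e (ℕ.suc n)) + q))
          (div-inner-ℕ a e n<k) (div-inner-ℕ b e n<k))
        (regroup (B (at e (ℕ.suc n)))
          (a (at e n)) (a (at e (ℕ.suc n))) (a (at e (ℕ.suc (ℕ.suc n))))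
          (b (at e n)) (b (at e (ℕ.suc n))) (b (at e (ℕ.suc (ℕ.suc n)))))
        where
        regroup : ∀ c a₀ a₁ a₂ b₀ b₁ b₂ →
          (c + ((a₁ - a₂) + (a₁ - a₀))) - (c + ((b₁ - b₂) + (b₁ - b₀)))
          ≡ ((a₁ - b₁) - (a₀ - b₀)) - ((a₂ - b₂) - (a₁ - b₁))
        regroup = solve-∀

      -- The increment at p, the step into `x`, is the largest on the path, so `F` is nonincreasing
      -- throughout. As it vanishes at i, it is nonnegative at 0 and nonpositive at m, so `min`
      -- agrees with b and a there and keeps their chips.
      descending : increment F p ≤ 0ℤ →
        (∀ n → n ℕ.< p → increment F n ≤ increment F (ℕ.suc n)) →
        (∀ n → p ℕ.≤ n → n ℕ.< k → increment F (ℕ.suc n) ≤ increment F n) →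
        Solvable H (B H.-ᴰ χ H x)
      descending Δp≤0 convex concave = solvable-between min win-min z≤n i≤m ℕ.≤-refl
        (ℤ.≤-trans chip-b (ℤ.+-monoʳ-≤ (B _) (div-⊓ʳ H a b _ (ℤ.0≤i-j⇒j≤i 0≤F0))))
        (ℤ.≤-trans chip-a (ℤ.+-monoʳ-≤ (B _) (div-⊓ˡ H a b _ (ℤ.i-j≤0⇒i≤j Fm≤0))))
        where
        left : ∀ n → 0 ℕ.≤ n → n ℕ.< i → F (ℕ.suc n) ≤ F n
        left n _ (s≤s n≤p) = ℤ.i-j≤0⇒i≤j (ℤ.≤-trans
          (monotone (increment F) (λ j _ j<p → convex j j<p) n≤p) Δp≤0)
        right : ∀ n → i ℕ.≤ n → n ℕ.< m → F (ℕ.suc n) ≤ F n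
        right n i≤n (s≤s n≤k) = ℤ.i-j≤0⇒i≤j (ℤ.≤-trans
          (antitone (increment F) (λ j p≤j j<n → concave j p≤j (ℕ.<-≤-trans j<n n≤k)) (ℕ.<⇒≤ i≤n)) Δp≤0)
        0≤F0 : 0ℤ ≤ F 0
        0≤F0 = subst (_≤ F 0) F-i (antitone F left z≤n)
        Fm≤0 : F m ≤ 0ℤ
        Fm≤0 = subst (F m ≤_) F-i (antitone F right i≤m)

      -- Just before `x`, a is below b by at least 1, while both agree at `x`. Replacing b by `min`
      -- thus raises the Laplacian at `x` by at least 1.
      ascending : 0ℤ < increment F p → Solvable H (B H.-ᴰ χ H x)
      ascending 0<Δp = solvable-take H B min win-min (≤-by
        -- The nonnegative summands are what b leaves at `x`, the excess of the increment over 1,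
        -- and the slack in `min` ≤ a before `x` and in `min` ≤ b after it.
        (0≤+ (0≤+ (win-b x) (ℤ.i≤j⇒0≤j-i (ℤ.i<j⇒suc[i]≤j 0<Δp)))
          (0≤+ (ℤ.i≤j⇒0≤j-i (ℤ.i⊓j≤i (a (at e p)) (b (at e p))))
               (ℤ.i≤j⇒0≤j-i (ℤ.i⊓j≤j (a (at e (ℕ.suc i))) (b (at e (ℕ.suc i)))))))
        (begin
          (chips b x + (F i - F p - 1ℤ)) + ((a₀ - min (at e p)) + (b₂ - min (at e (ℕ.suc i))))
            ≡⟨ cong₂ (λ d z → (B x + d + (z - F p - 1ℤ)) + ((a₀ - min (at e p)) + (b₂ - min (at e (ℕ.suc i)))))
                 (div-inner-ℕ b e p<k) F-i ⟩
          (B x + ((b x - b₂) + (b x - b₀)) + (0ℤ - (a₀ - b₀) - 1ℤ)) + ((a₀ - min (at e p)) + (b₂ - min (at e (ℕ.suc i))))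
            ≡⟨ regroup (B x) (b x) a₀ b₀ b₂ (min (at e p)) (min (at e (ℕ.suc i))) ⟩
          B x + ((b x - min (at e (ℕ.suc i))) + (b x - min (at e p))) - 1ℤ
            ≡⟨ cong (λ y → B x + ((y - min (at e (ℕ.suc i))) + (y - min (at e p))) - 1ℤ) min-x ⟨
          B x + ((min x - min (at e (ℕ.suc i))) + (min x - min (at e p))) - 1ℤ
            ≡⟨ cong (λ d → B x + d - 1ℤ) (div-inner-ℕ min e p<k) ⟨
          chips min x - 1ℤ ∎))
        where
        open ≡-Reasoning
        a₀ b₀ b₂ : ℤ
        a₀ = a (at e p)
        b₀ = b (at e p)
        b₂ = b (at e (ℕ.suc i))
        min-x : min x ≡ b x
        min-x = ℤ.i≥j⇒i⊓j≡j (ℤ.≤-reflexive (sym (ℤ.i-j≡0⇒i≡j (a x) (b x) F-i)))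
        regroup : ∀ c b₁ a₀ b₀ b₂ m₀ m₂ →
          (c + ((b₁ - b₂) + (b₁ - b₀)) + (0ℤ - (a₀ - b₀) - 1ℤ)) + ((a₀ - m₀) + (b₂ - m₂))
          ≡ c + ((b₁ - m₂) + (b₁ - m₀)) - 1ℤ
        regroup = solve-∀

      decide : Dec (∃[ n ] (n ℕ.< ℕ.suc m × (i ℕ.≤ n × 1ℤ ≤ chips b (at e n)))) →
               Dec (∃[ n ] (n ℕ.< ℕ.suc i × 1ℤ ≤ chips a (at e n))) →
               Solvable H (B H.-ᴰ χ H x)
      decide (yes (n , n<1+m , i≤n , chip)) _ =
        solvable-between b win-b z≤n i≤n (ℕ.≤-pred n<1+m) chip-b chip
      decide (no _) (yes (n , n<1+i , chip)) =
        solvable-between a win-a′ (ℕ.≤-pred n<1+i) i≤m ℕ.≤-refl chip chip-a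
      decide (no b-free) (no a-free) with increment F p ℤ.≤? 0ℤ
      ... | no Δp≰0 = ascending (ℤ.≰⇒> Δp≰0)
      ... | yes Δp≤0 = descending Δp≤0
        -- Before `x`, a leaves no chip and b leaves no debt, so the difference of their chips is at
        -- most 0.
        (λ n n<p → ℤ.i-j≤0⇒i≤j (subst (_≤ 0ℤ) (chips-difference n (ℕ.<-trans n<p p<k))
          (ℤ.i≤j⇒i-j≤0 (ℤ.≤-trans
            (≮1 (λ chip → a-free (ℕ.suc n , s≤s (ℕ.m≤n⇒m≤1+n n<p) , chip)))
            (win-b _)))))
        -- From `x` on the roles are exchanged; n = p is the position of `x` itself.
        (λ n p≤n n<k → ℤ.0≤i-j⇒j≤i (subst (0ℤ ≤_) (chips-difference n n<k)
          (ℤ.i≤j⇒0≤j-i (ℤ.≤-trans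
            (≮1 (λ chip → b-free (ℕ.suc n , s≤s (ℕ.m≤n⇒m≤1+n n<k) , s≤s p≤n , chip)))
            (win-a′ _)))))
        where
        ≮1 : ∀ {c} → ¬ 1ℤ ≤ c → c ≤ 0ℤ
        ≮1 ≰ = ℤ.i<j⇒i≤pred[j] (ℤ.≰⇒> ≰)

  -- Moving blocking divisors to old vertices

  -- One-chip form of the fact that the old vertices are a rank-determining set. Looplessness
  -- supplies the distinct ends that `solvable-inner` requires.
  solvable-at-old⇒everywhere : Loopless G → ∀ B → (∀ u → Solvable H (B H.-ᴰ χ H (old u))) →
                               ∀ x → Solvable H (B H.-ᴰ χ H x)
  solvable-at-old⇒everywhere loopless B s = vertex-elim _ s λ e i →
    solvable-inner B e (loopless e) (toℕ<n i) (s (src G e)) (s (tgt G e))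

  -- Induction on the degree. One chip x of E is absorbed into B, and the other chips move to old
  -- vertices by induction. Subtracting x last, some old vertex can take its place.
  blocking-at-old : Loopless G → ∀ n (E : Div H) → H.Effective E → H.deg E ≡ + n →
    ∀ B → ¬ Solvable H (B H.-ᴰ E) →
    ∃[ E′ ] (G.Effective E′ × G.deg E′ ≡ + n × ¬ Solvable H (B H.-ᴰ extend k G E′))
  blocking-at-old loopless ℕ.zero E E≥0 degE B blocked =
    const 0ℤ , (λ _ → ℤ.≤-refl) , sum-replicate-zero (#V G) ,
    λ s → blocked (solvable-≗ H (λ v → cong (λ x → B v - x) (trans (extend-0 v) (sym (E≡0 v)))) s)
    where
    E≡0 : ∀ v → E v ≡ 0ℤ
    E≡0 v = ℤ.≤-antisym (subst (E v ≤_) degE (∑-upper E E≥0 v)) (E≥0 v)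
    extend-0 : ∀ v → extend k G (const 0ℤ) v ≡ 0ℤ
    extend-0 = vertex-elim _ (extend-old (const 0ℤ))
      λ e i → extend-at-inner (const 0ℤ) e i
  blocking-at-old loopless (ℕ.suc n) E E≥0 degE B blocked
    with any? (λ v → 1ℤ ℤ.≤? E v)
  ... | no none = ⊥-elim (ℤ.<⇒≱ (+<+ (s≤s z≤n)) (subst (_≤ 0ℤ) degE (ℤ.≤-trans
          (∑-≤ E 0 λ v → ℤ.i<j⇒i≤pred[j] (ℤ.≰⇒> λ chip → none (v , chip)))
          (ℤ.≤-reflexive (cong +_ (ℕ.*-zeroʳ (#V H)))))))
  ... | yes (x , chip) = push-to-old (blocking-at-old loopless n (E H.-ᴰ χ H x)
          (effective-take H E E≥0 chip)
          (trans (∑-- E (χ H x)) (cong₂ _-_ degE (deg-χ H x)))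
          (B H.-ᴰ χ H x)
          (blocked ∘ solvable-≗ H λ v → regroup (B v) (χ H x v) (E v)))
    where
    regroup : ∀ b c e → (b - c) - (e - c) ≡ b - e
    regroup = solve-∀
    push-to-old : ∃[ E′ ] (G.Effective E′ × G.deg E′ ≡ + n × ¬ Solvable H (B H.-ᴰ χ H x H.-ᴰ extend k G E′)) →
                  ∃[ E′ ] (G.Effective E′ × G.deg E′ ≡ + ℕ.suc n × ¬ Solvable H (B H.-ᴰ extend k G E′))
    push-to-old (E′ , E′≥0 , degE′ , blocked′)
      -- If every old vertex allowed a solution, x would as well; decidability of solvability turns
      -- this contradiction into an explicit blocking vertex.
      with ¬∀⟶∃¬ (#V G) (λ u → Solvable H (B H.-ᴰ extend k G E′ H.-ᴰ χ H (old u)))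
             (λ u → H.winning? (B H.-ᴰ extend k G E′ H.-ᴰ χ H (old u)))
             (λ s → blocked′ (solvable-≗ H (λ v → swap (B v) (extend k G E′ v) (χ H x v))
               (solvable-at-old⇒everywhere loopless (B H.-ᴰ extend k G E′) s x)))
      where
      swap : ∀ b e c → (b - e) - c ≡ (b - c) - e
      swap = solve-∀
    ... | u , blockedᵤ = (λ v → E′ v + χ G u v) ,
          (λ v → 0≤+ (E′≥0 v) (0≤χ G u v)) ,
          trans (∑-distrib-+ E′ (χ G u)) (trans (cong₂ _+_ degE′ (deg-χ G u)) (ℤ.+-comm (+ n) 1ℤ)) ,
          blockedᵤ ∘ solvable-≗ H λ v →
            trans (cong (λ x → B v - x) (extend-+χ v)) (split (B v) (extend k G E′ v) (χ H (old u) v))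
      where
      split : ∀ b e c → b - (e + c) ≡ (b - e) - c
      split = solve-∀
      extend-+χ : ∀ v → extend k G (λ w → E′ w + χ G u w) v ≡ extend k G E′ v + χ H (old u) v
      extend-+χ = vertex-elim _
        (λ w → trans (extend-old _ w) (cong₂ _+_ (sym (extend-old E′ w))
          (if-cong (w ≟ u) (old w ≟ old u) (cong old) old-injective)))
        (λ e i → trans (extend-at-inner _ e i) (sym (cong₂ _+_ (extend-at-inner E′ e i)
          (χ-other H λ eq → old≢inner (trans (sym eq) (at-inner e i))))))

  -- Comparison of blocking degrees

  module _ (D : Div G) where

    extend-- : ∀ E v → extend k G (D G.-ᴰ E) v ≡ extend k G D v - extend k G E v
    extend-- E = vertex-elim _
      (λ u → trans (extend-old _ u) (sym (cong₂ _-_ (extend-old D u) (extend-old E u))))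
      (λ e i → trans (extend-at-inner _ e i) (sym (cong₂ _-_ (extend-at-inner D e i) (extend-at-inner E e i))))

    -- A solution on `H` would restrict to one on G, so a blocking divisor keeps blocking after
    -- extension by 0.
    blocking-extend : G.BlockingDegree D ⊆ H.BlockingDegree (extend k G D)
    blocking-extend (E , E≥0 , blocked , degE) =
      extend k G E , extend≥0 ,
      ¬solvable⇒empty H (empty⇒¬solvable G blocked ∘ solvable-restrict ∘ solvable-≗ H (sym ∘ extend-- E)) ,
      trans (∑-↑ (#V G) (extend k G E)) (trans
        (cong₂ _+_ (trans (sum-cong-≗ (extend-old E)) degE)
          (∑-zero {#E G ℕ.* k} λ y → cong [ E , const 0ℤ ]′ (splitAt-↑ʳ (#V G) _ y)))
        (ℤ.+-identityʳ _))
      where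
      extend≥0 : H.Effective (extend k G E)
      extend≥0 v with splitAt (#V G) v
      ... | inj₁ u = E≥0 u
      ... | inj₂ _ = ℤ.≤-refl

    -- Only divisors supported on old vertices come from G, hence the passage through
    -- `blocking-at-old`; a solution on G would then extend to `H`.
    blocking-restrict : Loopless G → H.BlockingDegree (extend k G D) ⊆ G.BlockingDegree D
    blocking-restrict loopless {d} (E , E≥0 , blocked , degE) =
      let +∣d∣≡d = ℤ.0≤i⇒+∣i∣≡i (subst (0ℤ ≤_) degE (∑-mono-0 E E≥0))
          E′ , E′≥0 , degE′ , blocked′ = blocking-at-old loopless ∣ d ∣ E E≥0 (trans degE (sym +∣d∣≡d))
            (extend k G D) (empty⇒¬solvable H blocked)
      in E′ , E′≥0 , ¬solvable⇒empty G (blocked′ ∘ solvable-≗ H (extend-- E′) ∘ solvable-extend) ,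
         trans degE′ +∣d∣≡d

corollary3p4 : (G : Graph) → Loopless G → (D : Div G) →
    (k : ℕ) → .{{_ : NonZero k}} →
    rank G D ≡ rank (subdivide k G) (extend k G D)
corollary3p4 G loopless D k = cong (_- 1ℤ) (minimum-unique
  (blocking-extend k G D) (blocking-restrict k G D loopless)
  (proj₂ (Divisors.minBlockingDegree G D))
  (proj₂ (Divisors.minBlockingDegree (subdivide k G) (extend k G D))))
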